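{- Let $\mathbf{X}_1,\ldots,\mathbf{X}_m\in\mathbb{C}^{d\times d}$ be matrices of rank at most $k$, and let $\{\mathbf{u}_{i,j}\}_{i\in[m],j\in[k]}\subset\mathbb{C}^d$ and $\{\mathbf{v}_{i,j}\}_{i\in[m],j\in[k]}\subset\mathbb{C}^d$ satisfy $\mathbf{X}_i=\sum_{j=1}^k\mathbf{u}_{i,j}\mathbf{v}_{i,j}^*$ for all $i\in[m]$. For $j\in[k]$ set $\mathbf{U}_j:=[\mathbf{u}_{1,j},\ldots,\mathbf{u}_{m,j}]\in\mathbb{C}^{d\times m}$ and $\mathbf{V}_j:=[\mathbf{v}_{1,j},\ldots,\mathbf{v}_{m,j}]\in\mathbb{C}^{d\times m}$, and let \[ \mathbf{A}:=\begin{pmatrix}\mathbf{V}_1^*\\ \vdots\\ \mathbf{V}_k^*\end{pmatrix}(\mathbf{U}_1,\ldots,\mathbf{U}_k)\in\mathbb{C}^{km\times km}. \] Then \[ \mu[\mathbf{X}_1,\ldots,\mathbf{X}_m](x)=x^{d-m}\cdot\psi_{k,m}[k\cdot\mathbf{A}](x). \]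
   Context: $[m]=\{1,\ldots,m\}$. The mixed characteristic polynomial is $\mu[\mathbf{X}_1,\ldots,\mathbf{X}_m](x):=\prod_{i=1}^m(1-\partial_{z_i})\det[x\mathbf{I}_d+\sum_{i=1}^m z_i\mathbf{X}_i]|_{z_1=\cdots=z_m=0}$. $\mathcal{P}_k(m)$ denotes the set of $k$-tuples $\mathcal{S}=(S_1,\ldots,S_k)$ of pairwise disjoint (possibly empty) subsets of $[m]$ with union $[m]$. For $\mathbf{B}\in\mathbb{C}^{km\times km}$, $\mathbf{B}(\mathcal{S})$ is the principal submatrix with rows and columns indexed by $S_1\cup(m+S_2)\cup\cdots\cup((k-1)m+S_k)$, and $\psi_{k,m}[\mathbf{B}](x):=\frac{1}{k^m}\sum_{\mathcal{S}\in\mathcal{P}_k(m)}\det[x\mathbf{I}_m-\mathbf{B}(\mathcal{S})]$. The identity is understood as an identity of rational functions in $x$. -}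

module Defs where

open import Level using (Level; Lift; lift; _⊔_) renaming (suc to lsuc)
open import Data.Unit.Polymorphic using (⊤)
open import Data.Product using (_×_; _,_)
open import Data.Nat using (ℕ; zero; suc)
open import Data.Fin using (Fin; zero; suc; toℕ; punchIn; combine; remQuot)
open import Data.List using (List; []; _∷_; map)
open import Relation.Nullary using (¬_)
open import Algebra.Bundles using (CommutativeRing)
open import Algebra.Bundles.Raw using (RawRing)

module RawOps {c ℓ} (R : RawRing c ℓ) where
  open RawRing R

  ΣFin : (n : ℕ) → (Fin n → Carrier) → Carrier
  ΣFin zero    f = 0#
  ΣFin (suc n) f = f zero + ΣFin n (λ i → f (suc i))

  fromℕ : ℕ → Carrier
  fromℕ zero    = 0#
  fromℕ (suc n) = 1# + fromℕ n

  _^_ : Carrier → ℕ → Carrier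
  a ^ zero  = 1#
  a ^ suc n = a * (a ^ n)

  sgn : ℕ → Carrier
  sgn zero    = 1#
  sgn (suc n) = - sgn n

  Mat : ℕ → Set c
  Mat n = Fin n → Fin n → Carrier

  det : (n : ℕ) → Mat n → Carrier
  det zero    M = 1#
  det (suc n) M =
    ΣFin (suc n) (λ j → (sgn (toℕ j) * M zero j) * det n (λ r s → M (suc r) (punchIn j s)))

-- Univariate polynomials over a raw ring: coefficient lists, lowest
-- degree first; equality is coefficientwise up to trailing zeros.

module PolyDef {c ℓ} (R : RawRing c ℓ) where
  open RawRing R

  P : Set c
  P = List Carrier

  _≈P_ : P → P → Set ℓ
  []       ≈P []       = ⊤
  []       ≈P (b ∷ q)  = (0# ≈ b) × ([] ≈P q)
  (a ∷ p)  ≈P []       = (a ≈ 0#) × (p ≈P [])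
  (a ∷ p)  ≈P (b ∷ q)  = (a ≈ b) × (p ≈P q)

  _+P_ : P → P → P
  []      +P q       = q
  (a ∷ p) +P []      = a ∷ p
  (a ∷ p) +P (b ∷ q) = (a + b) ∷ (p +P q)

  -P_ : P → P
  -P p = map -_ p

  _*P_ : P → P → P
  []      *P q = []
  (a ∷ p) *P q = map (a *_) q +P (0# ∷ (p *P q))

  C : Carrier → P
  C a = a ∷ []

  X : P
  X = 0# ∷ 1# ∷ []

  private
    _·_ : ℕ → Carrier → Carrier
    zero  · a = 0#
    suc n · a = a + (n · a)

    derivFrom : ℕ → P → P
    derivFrom n []      = []
    derivFrom n (a ∷ p) = (n · a) ∷ derivFrom (suc n) p

  ∂ : P → P
  ∂ []      = []
  ∂ (a ∷ p) = derivFrom 1 p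

  eval0 : P → Carrier
  eval0 []      = 0#
  eval0 (a ∷ p) = a

Poly : ∀ {c ℓ} → RawRing c ℓ → RawRing c ℓ
Poly R = record
  { Carrier = P ; _≈_ = _≈P_ ; _+_ = _+P_ ; _*_ = _*P_ ; -_ = -P_
  ; 0# = [] ; 1# = C 1# }
  where open RawRing R ; open PolyDef R

-- R[z_1]...[z_n]  (iterated polynomial ring; variable z_1 outermost)
PolyN : ∀ {c ℓ} → ℕ → RawRing c ℓ → RawRing c ℓ
PolyN zero    R = R
PolyN (suc n) R = Poly (PolyN n R)

module _ {c ℓ} (R : RawRing c ℓ) where
  private module R = RawRing R

  constN : (n : ℕ) → R.Carrier → RawRing.Carrier (PolyN n R)
  constN zero    a = a
  constN (suc n) a = PolyDef.C (PolyN n R) (constN n a)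

  varN : (n : ℕ) → Fin n → RawRing.Carrier (PolyN n R)
  varN (suc n) zero    = PolyDef.X (PolyN n R)
  varN (suc n) (suc i) = PolyDef.C (PolyN n R) (varN n i)

  -- ∏_{i=1}^n (1 - ∂_{z_i}) f  evaluated at z_1 = ... = z_n = 0
  -- (the operators for distinct variables commute, so they are applied
  --  from the outermost variable inwards, setting each variable to 0
  --  right after its operator has been applied)
  oneMinusDerivAt0 : (n : ℕ) → RawRing.Carrier (PolyN n R) → R.Carrier
  oneMinusDerivAt0 zero    f = f
  oneMinusDerivAt0 (suc n) f =
    oneMinusDerivAt0 n (eval0 (f +P (-P (∂ f))))
    where open PolyDef (PolyN n R)

-- A field of characteristic zero with an involutive ring automorphism
-- ("complex conjugation").  ℂ is the intended instance.

record ConjField c ℓ : Set (lsuc (c ⊔ ℓ)) where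
  field
    commRing : CommutativeRing c ℓ
  open CommutativeRing commRing public
  open RawOps rawRing public using (fromℕ)
  field
    _⁻¹       : Carrier → Carrier
    inverseʳ  : ∀ a → ¬ (a ≈ 0#) → a * (a ⁻¹) ≈ 1#
    charZero  : ∀ n → ¬ (fromℕ (suc n) ≈ 0#)
    conj      : Carrier → Carrier
    conj-cong : ∀ {a b} → a ≈ b → conj a ≈ conj b
    conj-+    : ∀ a b → conj (a + b) ≈ conj a + conj b
    conj-*    : ∀ a b → conj (a * b) ≈ conj a * conj b
    conj-1    : conj 1# ≈ 1#
    conj-conj : ∀ a → conj (conj a) ≈ a

module Objects {c ℓ} (F : ConjField c ℓ) where
  open ConjField F
  open RawOps rawRing public using (ΣFin; Mat; det; _^_)

  Fx : RawRing c ℓ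
  Fx = Poly rawRing

  Px : Set c
  Px = RawRing.Carrier Fx

  open PolyDef rawRing public using (_≈P_; _*P_; _+P_; -P_; C; X)
  open RawOps Fx public using () renaming (det to detP; ΣFin to ΣP; _^_ to _^P_)

  δ : ∀ {n} → Fin n → Fin n → Carrier
  δ zero    zero    = 1#
  δ zero    (suc j) = 0#
  δ (suc i) zero    = 0#
  δ (suc i) (suc j) = δ i j

  μ : (d m : ℕ) → (Fin m → Mat d) → Px
  μ d m Xs = oneMinusDerivAt0 Fx m (RawOps.det Pm d M)
    where
      Pm = PolyN m Fx
      open RawRing Pm renaming (_+_ to _⊕_; _*_ to _⊗_)
      M : Fin d → Fin d → RawRing.Carrier Pm
      M a b = (constN Fx m X ⊗ constN Fx m (C (δ a b)))
          ⊕ RawOps.ΣFin Pm m (λ i → varN Fx m i ⊗ constN Fx m (C (Xs i a b)))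

  -- all k-tuples (S_1,...,S_k) ∈ P_k(m), encoded by the map σ : [m] → [k]
  -- sending i to the index of the block containing it; sum over them
  consF : ∀ {m k} → Fin k → (Fin m → Fin k) → Fin (suc m) → Fin k
  consF a g zero    = a
  consF a g (suc i) = g i

  ΣAssign : (m k : ℕ) → ((Fin m → Fin k) → Px) → Px
  ΣAssign zero    k f = f (λ ())
  ΣAssign (suc m) k f = ΣP k (λ a → ΣAssign m k (λ g → f (consF a g)))

  -- principal submatrix B(S): rows/columns indexed by
  -- S_1 ∪ (m+S_2) ∪ ... ∪ ((k-1)m+S_k), i.e. by (σ(i)-1)m + i for i ∈ [m]
  subMat : (k m : ℕ) → Mat (k Data.Nat.* m) → (Fin m → Fin k) → Mat m
  subMat k m B σ i i' = B (combine (σ i) i) (combine (σ i') i')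

  charPoly : (m : ℕ) → Mat m → Px
  charPoly m M = detP m (λ a b → (X *P C (δ a b)) +P (-P (C (M a b))))

  ψ : (k m : ℕ) → Mat (k Data.Nat.* m) → Px
  ψ k m B = C ((fromℕ k ^ m) ⁻¹) *P ΣAssign m k (λ σ → charPoly m (subMat k m B σ))

  -- A = (V_1^*; ...; V_k^*)(U_1,...,U_k); entry in block (j,j'), position
  -- (i,i') is  v_{i,j}^* u_{i',j'} = Σ_a conj(v_{i,j}(a)) u_{i',j'}(a)
  Amat : (d m k : ℕ) → (u v : Fin m → Fin k → Fin d → Carrier) → Mat (k Data.Nat.* m)
  Amat d m k u v p q with remQuot m p | remQuot m q
  ... | j , i | j' , i' = ΣFin d (λ a → conj (v i j a) * u i' j' a)

  scale : ∀ {n} → Carrier → Mat n → Mat n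
  scale s M a b = s * M a b

{-# OPTIONS --safe #-}
module Submission where

-- For a matrix N, det (N + z X) has z-derivative at 0 linear in X, and is affine
-- in z when X has rank one.  With X = Σ_j u_j v_j^* (k summands), the value of
-- (1 - ∂_z) det (N + z X) at z = 0 is therefore the average over j of
-- det (N - k u_j v_j^*).  Doing this for every variable gives
--   k^m μ(x) = Σ_σ det (x I_d - Σ_i k u_{i,σ(i)} v_{i,σ(i)}^*),
-- and Sylvester's identity x^m det (x I_d - U V) = x^d det (x I_m - V U) turns
-- each summand into the characteristic polynomial of a submatrix of k A.
-- The Laplace determinant is the scalar left after contracting e_1 ∧ ... ∧ e_n
-- with the rows; row operations reduce to ι_r ι_r = 0 and ι_r ι_s = - ι_s ι_r.

open import Defs
open import Level using (_⊔_)
open import Data.Bool using (Bool; true; false)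
open import Data.Nat using (ℕ; zero; suc; _≤_; s≤s)
open import Data.List using ([]; _∷_; map)
open import Data.Vec using (Vec; []; _∷_; replicate)
open import Data.Product using (_,_)
open import Data.Unit.Polymorphic using (tt)
open import Data.Fin using (Fin; zero; suc; toℕ; punchIn; combine; _↑ˡ_; _↑ʳ_)
open import Data.Fin.Properties using (remQuot-combine; toℕ-↑ˡ)
open import Function using (_∘_)
open import Relation.Nullary using (¬_)
open import Relation.Binary.PropositionalEquality as ≡ using (_≡_)
open import Algebra.Bundles using (CommutativeRing)
open import Algebra.Bundles.Raw using (RawRing)
open import Algebra.Structures using (IsCommutativeRing)
import Data.Nat as ℕ
import Algebra.Properties.Ring as RingProperties
import Algebra.Properties.CommutativeSemigroup as CommutativeSemigroupProperties
import Relation.Binary.Reasoning.Setoid as SetoidReasoning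

-- The factor `k` is forced by the averaging. Let D_j be the derivative of det at N along u_j v_j^*.
-- By linearity of the derivative in X, the value of (1 - ∂_z) det (N + z X) at 0 is det N - Σ_j
-- D_j. Spreading det N evenly over the k summands gives (1/k) Σ_j (det N - k D_j), and affineness
-- along u_j v_j^* makes the j-th summand an exact determinant. The perturbed matrix is again
-- constant in the remaining variables, so the induction on m has to carry an arbitrary constant
-- matrix in place of x I_d. Divisions are postponed: the averaging is multiplied by k^m and
-- Sylvester's identity by x^m, so an inverse is taken only in the last step. Determinants occur
-- over F[x][z_1]...[z_n] for every n, hence the determinant theory is developed over an arbitrary
-- commutative ring. Expansion along the first row alone makes neither alternation nor operations
-- between arbitrary rows evident, which is the reason for passing to contractions.

IsCR : ∀ {c ℓ} → RawRing c ℓ → Set (c ⊔ ℓ)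
IsCR R = IsCommutativeRing _≈_ _+_ _*_ -_ 0# 1#
  where open RawRing R

-- Only laws are added to the raw operations, so ring lemmas apply directly to `det`, `PolyN` and
-- `μ`, which are defined on raw rings.
toCR : ∀ {c ℓ} (R : RawRing c ℓ) → IsCR R → CommutativeRing c ℓ
toCR R isCR = record
  { Carrier = Carrier ; _≈_ = _≈_ ; _+_ = _+_ ; _*_ = _*_ ; -_ = -_
  ; 0# = 0# ; 1# = 1# ; isCommutativeRing = isCR }
  where open RawRing R

-- The commutative ring of coefficient lists

module PolynomialRing {c ℓ} (R : CommutativeRing c ℓ) where
  open CommutativeRing R hiding (zero)
  open PolyDef rawRing
  open RingProperties ring using (-0#≈0#)
  open CommutativeSemigroupProperties +-commutativeSemigroup using (interchange)
  open SetoidReasoning setoid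

  -- Indices beyond the end read as `0#`, so trailing zeros are invisible, and the ring laws for
  -- `_≈P_` reduce to pointwise identities between coefficients.
  coeff : P → ℕ → Carrier
  coeff []      n       = 0#
  coeff (a ∷ p) zero    = a
  coeff (a ∷ p) (suc n) = coeff p n

  coeff-cong : ∀ {p q} → p ≈P q → ∀ n → coeff p n ≈ coeff q n
  coeff-cong {[]}    {[]}    e       n       = refl
  coeff-cong {[]}    {b ∷ q} (e , _) zero    = e
  coeff-cong {[]}    {b ∷ q} (_ , e) (suc n) = coeff-cong {[]} {q} e n
  coeff-cong {a ∷ p} {[]}    (e , _) zero    = e
  coeff-cong {a ∷ p} {[]}    (_ , e) (suc n) = coeff-cong {p} {[]} e n
  coeff-cong {a ∷ p} {b ∷ q} (e , _) zero    = e
  coeff-cong {a ∷ p} {b ∷ q} (_ , e) (suc n) = coeff-cong {p} {q} e n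

  coeff-ext : ∀ {p q} → (∀ n → coeff p n ≈ coeff q n) → p ≈P q
  coeff-ext {[]}    {[]}    h = tt
  coeff-ext {[]}    {b ∷ q} h = h zero , coeff-ext {[]} {q} λ n → h (suc n)
  coeff-ext {a ∷ p} {[]}    h = h zero , coeff-ext {p} {[]} λ n → h (suc n)
  coeff-ext {a ∷ p} {b ∷ q} h = h zero , coeff-ext {p} {q} λ n → h (suc n)

  coeff-+ : ∀ p q n → coeff (p +P q) n ≈ coeff p n + coeff q n
  coeff-+ []      q       n       = sym (+-identityˡ _)
  coeff-+ (a ∷ p) []      n       = sym (+-identityʳ _)
  coeff-+ (a ∷ p) (b ∷ q) zero    = refl
  coeff-+ (a ∷ p) (b ∷ q) (suc n) = coeff-+ p q n

  coeff-neg : ∀ p n → coeff (-P p) n ≈ - coeff p n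
  coeff-neg []      n       = sym -0#≈0#
  coeff-neg (a ∷ p) zero    = refl
  coeff-neg (a ∷ p) (suc n) = coeff-neg p n

  coeff-scale : ∀ a p n → coeff (map (a *_) p) n ≈ a * coeff p n
  coeff-scale a []      n       = sym (zeroʳ a)
  coeff-scale a (b ∷ p) zero    = refl
  coeff-scale a (b ∷ p) (suc n) = coeff-scale a p n

  coeff-*-zero : ∀ a p q → coeff ((a ∷ p) *P q) zero ≈ a * coeff q zero
  coeff-*-zero a p q = begin
    coeff ((a ∷ p) *P q) zero        ≈⟨ coeff-+ (map (a *_) q) _ zero ⟩
    coeff (map (a *_) q) zero + 0#   ≈⟨ +-identityʳ _ ⟩
    coeff (map (a *_) q) zero        ≈⟨ coeff-scale a q zero ⟩
    a * coeff q zero                 ∎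

  coeff-*-suc : ∀ a p q n → coeff ((a ∷ p) *P q) (suc n) ≈ a * coeff q (suc n) + coeff (p *P q) n
  coeff-*-suc a p q n =
    trans (coeff-+ (map (a *_) q) _ (suc n)) (+-congʳ (coeff-scale a q (suc n)))

  *P-congʳ : ∀ p {q q′} → q ≈P q′ → ∀ n → coeff (p *P q) n ≈ coeff (p *P q′) n
  *P-congʳ []      e n = refl
  *P-congʳ (a ∷ p) {q} {q′} e zero =
    trans (coeff-*-zero a p q) (trans (*-congˡ (coeff-cong e zero)) (sym (coeff-*-zero a p q′)))
  *P-congʳ (a ∷ p) {q} {q′} e (suc n) = begin
    coeff ((a ∷ p) *P q) (suc n)                 ≈⟨ coeff-*-suc a p q n ⟩
    a * coeff q (suc n) + coeff (p *P q) n       ≈⟨ +-cong (*-congˡ (coeff-cong e (suc n))) (*P-congʳ p e n) ⟩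
    a * coeff q′ (suc n) + coeff (p *P q′) n     ≈⟨ coeff-*-suc a p q′ n ⟨
    coeff ((a ∷ p) *P q′) (suc n)                ∎

  *P-[] : ∀ p n → coeff (p *P []) n ≈ 0#
  *P-[] []      n       = refl
  *P-[] (a ∷ p) zero    = refl
  *P-[] (a ∷ p) (suc n) = *P-[] p n

  -- The product recurses on its left factor only, so commutativity needs a simultaneous induction
  -- on both factors. Peeling `a` and `b` leaves a q, b p and a shifted product of p and q; this is
  -- symmetric once the smaller products commute.
  *P-∷ : ∀ p b q n → coeff (p *P (b ∷ q)) n ≈ coeff ((b ∷ q) *P p) n
  *P-comm : ∀ p q n → coeff (p *P q) n ≈ coeff (q *P p) n

  *P-∷ [] b q n = sym (*P-[] (b ∷ q) n)
  *P-∷ (a ∷ p) b q zero = +-congʳ (*-comm a b)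
  *P-∷ (a ∷ p) b q (suc n) = begin
    coeff ((a ∷ p) *P (b ∷ q)) (suc n)          ≈⟨ coeff-*-suc a p (b ∷ q) n ⟩
    a * coeff q n + coeff (p *P (b ∷ q)) n      ≈⟨ +-congˡ (*P-∷ p b q n) ⟩
    a * coeff q n + coeff ((b ∷ q) *P p) n      ≈⟨ shift n ⟩
    b * coeff p n + coeff ((a ∷ p) *P q) n      ≈⟨ +-congˡ (*P-comm (a ∷ p) q n) ⟩
    b * coeff p n + coeff (q *P (a ∷ p)) n      ≈⟨ coeff-*-suc b q (a ∷ p) n ⟨
    coeff ((b ∷ q) *P (a ∷ p)) (suc n)          ∎
    where
    swap : ∀ x y z → x + (y + z) ≈ y + (x + z)
    swap x y z = trans (sym (+-assoc x y z)) (trans (+-congʳ (+-comm x y)) (+-assoc y x z))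
    shift : ∀ n → a * coeff q n + coeff ((b ∷ q) *P p) n ≈ b * coeff p n + coeff ((a ∷ p) *P q) n
    shift zero = begin
      a * coeff q zero + coeff ((b ∷ q) *P p) zero   ≈⟨ +-congˡ (coeff-*-zero b q p) ⟩
      a * coeff q zero + b * coeff p zero            ≈⟨ +-comm _ _ ⟩
      b * coeff p zero + a * coeff q zero            ≈⟨ +-congˡ (coeff-*-zero a p q) ⟨
      b * coeff p zero + coeff ((a ∷ p) *P q) zero   ∎
    shift (suc n) = begin
      a * coeff q (suc n) + coeff ((b ∷ q) *P p) (suc n)                  ≈⟨ +-congˡ (coeff-*-suc b q p n) ⟩
      a * coeff q (suc n) + (b * coeff p (suc n) + coeff (q *P p) n)      ≈⟨ swap _ _ _ ⟩
      b * coeff p (suc n) + (a * coeff q (suc n) + coeff (q *P p) n)      ≈⟨ +-congˡ (+-congˡ (*P-comm p q n)) ⟨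
      b * coeff p (suc n) + (a * coeff q (suc n) + coeff (p *P q) n)      ≈⟨ +-congˡ (coeff-*-suc a p q n) ⟨
      b * coeff p (suc n) + coeff ((a ∷ p) *P q) (suc n)                  ∎

  *P-comm p []      n = *P-[] p n
  *P-comm p (b ∷ q) n = *P-∷ p b q n

  *P-congˡ : ∀ {p p′} q → p ≈P p′ → ∀ n → coeff (p *P q) n ≈ coeff (p′ *P q) n
  *P-congˡ {p} {p′} q e n = trans (*P-comm p q n) (trans (*P-congʳ q e n) (*P-comm q p′ n))

  *P-distribˡ : ∀ p q r n → coeff (p *P (q +P r)) n ≈ coeff (p *P q) n + coeff (p *P r) n
  *P-distribˡ []      q r n = sym (+-identityʳ 0#)
  *P-distribˡ (a ∷ p) q r zero = begin
    coeff ((a ∷ p) *P (q +P r)) zero                        ≈⟨ coeff-*-zero a p (q +P r) ⟩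
    a * coeff (q +P r) zero                                 ≈⟨ *-congˡ (coeff-+ q r zero) ⟩
    a * (coeff q zero + coeff r zero)                       ≈⟨ distribˡ _ _ _ ⟩
    a * coeff q zero + a * coeff r zero                     ≈⟨ +-cong (coeff-*-zero a p q) (coeff-*-zero a p r) ⟨
    coeff ((a ∷ p) *P q) zero + coeff ((a ∷ p) *P r) zero   ∎
  *P-distribˡ (a ∷ p) q r (suc n) = begin
    coeff ((a ∷ p) *P (q +P r)) (suc n)
      ≈⟨ coeff-*-suc a p (q +P r) n ⟩
    a * coeff (q +P r) (suc n) + coeff (p *P (q +P r)) n
      ≈⟨ +-cong (trans (*-congˡ (coeff-+ q r (suc n))) (distribˡ _ _ _)) (*P-distribˡ p q r n) ⟩
    (a * coeff q (suc n) + a * coeff r (suc n)) + (coeff (p *P q) n + coeff (p *P r) n)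
      ≈⟨ interchange _ _ _ _ ⟩
    (a * coeff q (suc n) + coeff (p *P q) n) + (a * coeff r (suc n) + coeff (p *P r) n)
      ≈⟨ +-cong (coeff-*-suc a p q n) (coeff-*-suc a p r n) ⟨
    coeff ((a ∷ p) *P q) (suc n) + coeff ((a ∷ p) *P r) (suc n)
      ∎

  *P-distribʳ : ∀ p q r n → coeff ((q +P r) *P p) n ≈ coeff (q *P p) n + coeff (r *P p) n
  *P-distribʳ p q r n = begin
    coeff ((q +P r) *P p) n              ≈⟨ *P-comm (q +P r) p n ⟩
    coeff (p *P (q +P r)) n              ≈⟨ *P-distribˡ p q r n ⟩
    coeff (p *P q) n + coeff (p *P r) n  ≈⟨ +-cong (*P-comm p q n) (*P-comm p r n) ⟩
    coeff (q *P p) n + coeff (r *P p) n  ∎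

  *P-scale : ∀ a p q n → coeff (map (a *_) p *P q) n ≈ a * coeff (p *P q) n
  *P-scale a []      q n = sym (zeroʳ a)
  *P-scale a (b ∷ p) q zero = begin
    coeff (map (a *_) (b ∷ p) *P q) zero   ≈⟨ coeff-*-zero (a * b) (map (a *_) p) q ⟩
    (a * b) * coeff q zero                 ≈⟨ *-assoc a b _ ⟩
    a * (b * coeff q zero)                 ≈⟨ *-congˡ (coeff-*-zero b p q) ⟨
    a * coeff ((b ∷ p) *P q) zero          ∎
  *P-scale a (b ∷ p) q (suc n) = begin
    coeff (map (a *_) (b ∷ p) *P q) (suc n)                        ≈⟨ coeff-*-suc (a * b) (map (a *_) p) q n ⟩
    (a * b) * coeff q (suc n) + coeff (map (a *_) p *P q) n        ≈⟨ +-cong (*-assoc a b _) (*P-scale a p q n) ⟩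
    a * (b * coeff q (suc n)) + a * coeff (p *P q) n               ≈⟨ distribˡ a _ _ ⟨
    a * (b * coeff q (suc n) + coeff (p *P q) n)                   ≈⟨ *-congˡ (coeff-*-suc b p q n) ⟨
    a * coeff ((b ∷ p) *P q) (suc n)                               ∎

  *P-shift-zero : ∀ p q → coeff ((0# ∷ p) *P q) zero ≈ 0#
  *P-shift-zero p q = trans (coeff-*-zero 0# p q) (zeroˡ _)

  *P-shift-suc : ∀ p q n → coeff ((0# ∷ p) *P q) (suc n) ≈ coeff (p *P q) n
  *P-shift-suc p q n = trans (coeff-*-suc 0# p q n) (trans (+-congʳ (zeroˡ _)) (+-identityˡ _))

  *P-assoc : ∀ p q r n → coeff ((p *P q) *P r) n ≈ coeff (p *P (q *P r)) n
  *P-assoc []      q r n = refl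
  *P-assoc (a ∷ p) q r zero = begin
    coeff (((a ∷ p) *P q) *P r) zero
      ≈⟨ *P-distribʳ r (map (a *_) q) (0# ∷ (p *P q)) zero ⟩
    coeff (map (a *_) q *P r) zero + coeff ((0# ∷ (p *P q)) *P r) zero
      ≈⟨ +-cong (*P-scale a q r zero) (*P-shift-zero (p *P q) r) ⟩
    a * coeff (q *P r) zero + 0#
      ≈⟨ +-identityʳ _ ⟩
    a * coeff (q *P r) zero
      ≈⟨ coeff-*-zero a p (q *P r) ⟨
    coeff ((a ∷ p) *P (q *P r)) zero
      ∎
  *P-assoc (a ∷ p) q r (suc n) = begin
    coeff (((a ∷ p) *P q) *P r) (suc n)
      ≈⟨ *P-distribʳ r (map (a *_) q) (0# ∷ (p *P q)) (suc n) ⟩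
    coeff (map (a *_) q *P r) (suc n) + coeff ((0# ∷ (p *P q)) *P r) (suc n)
      ≈⟨ +-cong (*P-scale a q r (suc n)) (*P-shift-suc (p *P q) r n) ⟩
    a * coeff (q *P r) (suc n) + coeff ((p *P q) *P r) n
      ≈⟨ +-congˡ (*P-assoc p q r n) ⟩
    a * coeff (q *P r) (suc n) + coeff (p *P (q *P r)) n
      ≈⟨ coeff-*-suc a p (q *P r) n ⟨
    coeff ((a ∷ p) *P (q *P r)) (suc n)
      ∎

  *P-C : ∀ a q n → coeff (C a *P q) n ≈ a * coeff q n
  *P-C a q zero    = coeff-*-zero a [] q
  *P-C a q (suc n) = trans (coeff-*-suc a [] q n) (+-identityʳ _)

  *P-identityˡ : ∀ p n → coeff (C 1# *P p) n ≈ coeff p n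
  *P-identityˡ p n = trans (*P-C 1# p n) (*-identityˡ _)

  isCR : IsCR (Poly rawRing)
  isCR = record
    { isRing = record
      { +-isAbelianGroup = record
        { isGroup = record
          { isMonoid = record
            { isSemigroup = record
              { isMagma = record
                { isEquivalence = record
                  { refl = λ {p} → coeff-ext {p} {p} λ n → refl
                  ; sym = λ {p} {q} e → coeff-ext {q} {p} λ n → sym (coeff-cong e n)
                  ; trans = λ {p} {q} {r} e e′ → coeff-ext {p} {r} λ n →
                      trans (coeff-cong e n) (coeff-cong e′ n)
                  }
                ; ∙-cong = λ {p} {p′} {q} {q′} e e′ → coeff-ext {p +P q} {p′ +P q′} λ n →
                    trans (coeff-+ p q n) (trans (+-cong (coeff-cong e n) (coeff-cong e′ n))
                      (sym (coeff-+ p′ q′ n)))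
                }
              ; assoc = λ p q r → coeff-ext {(p +P q) +P r} {p +P (q +P r)} λ n → begin
                  coeff ((p +P q) +P r) n                ≈⟨ coeff-+ (p +P q) r n ⟩
                  coeff (p +P q) n + coeff r n           ≈⟨ +-congʳ (coeff-+ p q n) ⟩
                  (coeff p n + coeff q n) + coeff r n    ≈⟨ +-assoc _ _ _ ⟩
                  coeff p n + (coeff q n + coeff r n)    ≈⟨ +-congˡ (coeff-+ q r n) ⟨
                  coeff p n + coeff (q +P r) n           ≈⟨ coeff-+ p (q +P r) n ⟨
                  coeff (p +P (q +P r)) n                ∎
              }
            ; identity = (λ p → coeff-ext {p} {p} λ n → refl)
                       , (λ p → coeff-ext {p +P []} {p} λ n →
                           trans (coeff-+ p [] n) (+-identityʳ _))
            }
          ; inverse = (λ p → coeff-ext {(-P p) +P p} {[]} λ n →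
                         trans (coeff-+ (-P p) p n) (trans (+-congʳ (coeff-neg p n)) (-‿inverseˡ _)))
                    , (λ p → coeff-ext {p +P (-P p)} {[]} λ n →
                         trans (coeff-+ p (-P p) n) (trans (+-congˡ (coeff-neg p n)) (-‿inverseʳ _)))
          ; ⁻¹-cong = λ {p} {q} e → coeff-ext { -P p} { -P q} λ n →
              trans (coeff-neg p n) (trans (-‿cong (coeff-cong e n)) (sym (coeff-neg q n)))
          }
        ; comm = λ p q → coeff-ext {p +P q} {q +P p} λ n →
            trans (coeff-+ p q n) (trans (+-comm _ _) (sym (coeff-+ q p n)))
        }
      ; *-cong = λ {p} {p′} {q} {q′} e e′ → coeff-ext {p *P q} {p′ *P q′} λ n →
          trans (*P-congˡ q e n) (*P-congʳ p′ e′ n)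
      ; *-assoc = λ p q r → coeff-ext {(p *P q) *P r} {p *P (q *P r)} (*P-assoc p q r)
      ; *-identity = (λ p → coeff-ext {C 1# *P p} {p} (*P-identityˡ p))
                   , (λ p → coeff-ext {p *P C 1#} {p} λ n → trans (*P-comm p (C 1#) n) (*P-identityˡ p n))
      ; distrib = (λ p q r → coeff-ext {p *P (q +P r)} {(p *P q) +P (p *P r)} λ n →
                     trans (*P-distribˡ p q r n) (sym (coeff-+ (p *P q) (p *P r) n)))
                , (λ p q r → coeff-ext {(q +P r) *P p} {(q *P p) +P (r *P p)} λ n →
                     trans (*P-distribʳ p q r n) (sym (coeff-+ (q *P p) (r *P p) n)))
      }
    ; *-comm = λ p q → coeff-ext {p *P q} {q *P p} (*P-comm p q)
    }

  coeff₀-* : ∀ p q → coeff (p *P q) 0 ≈ coeff p 0 * coeff q 0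
  coeff₀-* []      q = sym (zeroˡ _)
  coeff₀-* (a ∷ p) q = coeff-*-zero a p q

  -- The product rule at 0. Degrees 0 and 1 are all that `1 - ∂` followed by evaluation at 0 can
  -- see.
  coeff₁-* : ∀ p q → coeff (p *P q) 1 ≈ coeff p 1 * coeff q 0 + coeff p 0 * coeff q 1
  coeff₁-* []          q = sym (trans (+-cong (zeroˡ _) (zeroˡ _)) (+-identityˡ _))
  coeff₁-* (a ∷ p) q = begin
    coeff ((a ∷ p) *P q) 1                     ≈⟨ coeff-*-suc a p q 0 ⟩
    a * coeff q 1 + coeff (p *P q) 0           ≈⟨ +-comm _ _ ⟩
    coeff (p *P q) 0 + a * coeff q 1           ≈⟨ +-congʳ (coeff₀-* p q) ⟩
    coeff p 0 * coeff q 0 + a * coeff q 1      ∎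

PolyN-isCR : ∀ {c ℓ} n {R : RawRing c ℓ} → IsCR R → IsCR (PolyN n R)
PolyN-isCR zero    isCR = isCR
PolyN-isCR (suc n) {R} isCR = PolynomialRing.isCR (toCR (PolyN n R) (PolyN-isCR n isCR))

-- Finite sums and the identity matrix

module FiniteSums {c ℓ} (R : CommutativeRing c ℓ) where
  open CommutativeRing R hiding (zero)
  open RawOps rawRing
  open CommutativeSemigroupProperties +-commutativeSemigroup using (interchange)

  Σ-cong : ∀ n {f g : Fin n → Carrier} → (∀ i → f i ≈ g i) → ΣFin n f ≈ ΣFin n g
  Σ-cong zero    h = refl
  Σ-cong (suc n) h = +-cong (h zero) (Σ-cong n (h ∘ suc))

  Σ-zero : ∀ n {f : Fin n → Carrier} → (∀ i → f i ≈ 0#) → ΣFin n f ≈ 0#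
  Σ-zero zero    h = refl
  Σ-zero (suc n) h = trans (+-cong (h zero) (Σ-zero n (h ∘ suc))) (+-identityˡ 0#)

  Σ-+ : ∀ n (f g : Fin n → Carrier) → ΣFin n (λ i → f i + g i) ≈ ΣFin n f + ΣFin n g
  Σ-+ zero    f g = sym (+-identityˡ 0#)
  Σ-+ (suc n) f g = trans (+-congˡ (Σ-+ n (f ∘ suc) (g ∘ suc))) (interchange _ _ _ _)

  Σ-*ˡ : ∀ n a (f : Fin n → Carrier) → ΣFin n (λ i → a * f i) ≈ a * ΣFin n f
  Σ-*ˡ zero    a f = sym (zeroʳ a)
  Σ-*ˡ (suc n) a f = trans (+-congˡ (Σ-*ˡ n a (f ∘ suc))) (sym (distribˡ a _ _))

  Σ-const : ∀ n a → ΣFin n (λ _ → a) ≈ fromℕ n * a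
  Σ-const zero    a = sym (zeroˡ a)
  Σ-const (suc n) a = trans (+-cong (sym (*-identityˡ a)) (Σ-const n a)) (sym (distribʳ a 1# _))

  Σ-split : ∀ m n (f : Fin (m ℕ.+ n) → Carrier) →
    ΣFin (m ℕ.+ n) f ≈ ΣFin m (λ i → f (i ↑ˡ n)) + ΣFin n (λ j → f (m ↑ʳ j))
  Σ-split zero    n f = sym (+-identityˡ _)
  Σ-split (suc m) n f = trans (+-congˡ (Σ-split m n (f ∘ suc))) (sym (+-assoc _ _ _))

  -- The identity matrix over any ring; `δ` has entries in the base field, while Sylvester's
  -- identity is applied over F[x].
  kronecker : ∀ {n} → Fin n → Fin n → Carrier
  kronecker zero    zero    = 1#
  kronecker zero    (suc j) = 0#
  kronecker (suc i) zero    = 0#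
  kronecker (suc i) (suc j) = kronecker i j

  Σ-kronecker : ∀ n (f : Fin n → Carrier) j → ΣFin n (λ i → f i * kronecker i j) ≈ f j
  Σ-kronecker (suc n) f zero =
    trans (+-cong (*-identityʳ _) (Σ-zero n (λ i → zeroʳ _))) (+-identityʳ _)
  Σ-kronecker (suc n) f (suc j) =
    trans (+-cong (zeroʳ _) (Σ-kronecker n (f ∘ suc) j)) (+-identityˡ _)

-- Contractions of the exterior algebra, the determinant and its derivative

module Contraction {c ℓ} (R : CommutativeRing c ℓ) where
  open CommutativeRing R hiding (zero)
  open RawOps rawRing
  open FiniteSums R
  open RingProperties ring using (-0#≈0#; -‿involutive; -‿distribˡ-*; -‿distribʳ-*; -‿+-comm; -1*x≈-x)
  open CommutativeSemigroupProperties +-commutativeSemigroup using (interchange)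
  open CommutativeSemigroupProperties *-commutativeSemigroup using () renaming (x∙yz≈y∙xz to x*yz≈y*xz)
  open SetoidReasoning setoid

  Row : ℕ → Set c
  Row n = Fin n → Carrier

  -- The exterior algebra of Rⁿ: w S is the coefficient of the wedge of the e_i
  -- with i ∈ S, and ι r is the contraction with the linear form r.
  Λ : ℕ → Set c
  Λ n = Vec Bool n → Carrier

  ι : ∀ {n} → Row n → Λ n → Λ n
  ι r w []          = 0#
  ι r w (false ∷ S) = ι (r ∘ suc) (w ∘ (false ∷_)) S + r zero * w (true ∷ S)
  ι r w (true  ∷ S) = - ι (r ∘ suc) (w ∘ (true ∷_)) S

  ι-cong : ∀ {n} {r r′ : Row n} {w w′ : Λ n} → (∀ i → r i ≈ r′ i) → (∀ S → w S ≈ w′ S) →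
    ∀ S → ι r w S ≈ ι r′ w′ S
  ι-cong hr hw []          = refl
  ι-cong hr hw (false ∷ S) =
    +-cong (ι-cong (hr ∘ suc) (hw ∘ (false ∷_)) S) (*-cong (hr zero) (hw (true ∷ S)))
  ι-cong hr hw (true ∷ S)  = -‿cong (ι-cong (hr ∘ suc) (hw ∘ (true ∷_)) S)

  ι-+ʳ : ∀ {n} (r : Row n) (w w′ : Λ n) S → ι r (λ S → w S + w′ S) S ≈ ι r w S + ι r w′ S
  ι-+ʳ r w w′ []          = sym (+-identityˡ 0#)
  ι-+ʳ r w w′ (false ∷ S) = trans (+-cong (ι-+ʳ (r ∘ suc) _ _ S) (distribˡ _ _ _)) (interchange _ _ _ _)
  ι-+ʳ r w w′ (true ∷ S)  = trans (-‿cong (ι-+ʳ (r ∘ suc) _ _ S)) (sym (-‿+-comm _ _))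

  ι-*ʳ : ∀ {n} (r : Row n) a (w : Λ n) S → ι r (λ S → a * w S) S ≈ a * ι r w S
  ι-*ʳ r a w []          = sym (zeroʳ a)
  ι-*ʳ r a w (false ∷ S) = trans (+-cong (ι-*ʳ (r ∘ suc) a _ S) (x*yz≈y*xz _ _ _)) (sym (distribˡ a _ _))
  ι-*ʳ r a w (true ∷ S)  = trans (-‿cong (ι-*ʳ (r ∘ suc) a _ S)) (-‿distribʳ-* a _)

  ι-+ˡ : ∀ {n} (r r′ : Row n) (w : Λ n) S → ι (λ i → r i + r′ i) w S ≈ ι r w S + ι r′ w S
  ι-+ˡ r r′ w []          = sym (+-identityˡ 0#)
  ι-+ˡ r r′ w (false ∷ S) = trans (+-cong (ι-+ˡ (r ∘ suc) _ _ S) (distribʳ _ _ _)) (interchange _ _ _ _)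
  ι-+ˡ r r′ w (true ∷ S)  = trans (-‿cong (ι-+ˡ (r ∘ suc) _ _ S)) (sym (-‿+-comm _ _))

  ι-*ˡ : ∀ {n} a (r : Row n) (w : Λ n) S → ι (λ i → a * r i) w S ≈ a * ι r w S
  ι-*ˡ a r w []          = sym (zeroʳ a)
  ι-*ˡ a r w (false ∷ S) = trans (+-cong (ι-*ˡ a (r ∘ suc) _ S) (*-assoc _ _ _)) (sym (distribˡ a _ _))
  ι-*ˡ a r w (true ∷ S)  = trans (-‿cong (ι-*ˡ a (r ∘ suc) _ S)) (-‿distribʳ-* a _)

  ι-0ʳ : ∀ {n} (r : Row n) {w : Λ n} → (∀ S → w S ≈ 0#) → ∀ S → ι r w S ≈ 0#
  ι-0ʳ r {w} hw S = begin
    ι r w S                ≈⟨ ι-cong (λ _ → refl) (λ S → trans (hw S) (sym (zeroˡ (w S)))) S ⟩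
    ι r (λ S → 0# * w S) S ≈⟨ ι-*ʳ r 0# w S ⟩
    0# * ι r w S           ≈⟨ zeroˡ _ ⟩
    0#                     ∎

  ι-0ˡ : ∀ {n} (w : Λ n) S → ι (λ _ → 0#) w S ≈ 0#
  ι-0ˡ w S = trans (ι-cong (λ i → sym (zeroˡ 0#)) (λ _ → refl) S)
               (trans (ι-*ˡ 0# (λ _ → 0#) w S) (zeroˡ _))

  ι-negʳ : ∀ {n} (r : Row n) (w : Λ n) S → ι r (λ S → - w S) S ≈ - ι r w S
  ι-negʳ r w S = trans (ι-cong (λ _ → refl) (λ S → sym (-1*x≈-x (w S))) S)
                   (trans (ι-*ʳ r (- 1#) w S) (-1*x≈-x _))

  ι-Σˡ : ∀ {n} l (a : Fin l → Carrier) (B : Fin l → Row n) (w : Λ n) S →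
    ι (λ s → ΣFin l (λ i → a i * B i s)) w S ≈ ΣFin l (λ i → a i * ι (B i) w S)
  ι-Σˡ zero    a B w S = ι-0ˡ w S
  ι-Σˡ (suc l) a B w S =
    trans (ι-+ˡ _ _ w S) (+-cong (ι-*ˡ (a zero) (B zero) w S) (ι-Σˡ l (a ∘ suc) (B ∘ suc) w S))

  -- Split by whether the first basis vector is present. The two mixed terms `r zero * ι r⁺ w₁ S`
  -- cancel, because passing that vector costs a sign.
  ι-square : ∀ {n} (r : Row n) (w : Λ n) S → ι r (ι r w) S ≈ 0#
  ι-square r w []          = refl
  ι-square r w (false ∷ S) = begin
    ι r⁺ (λ S → ι r⁺ w₀ S + r zero * w₁ S) S + r zero * (- ι r⁺ w₁ S)
      ≈⟨ +-cong (trans (ι-+ʳ r⁺ _ _ S) (+-cong (ι-square r⁺ w₀ S) (ι-*ʳ r⁺ (r zero) w₁ S))) (sym (-‿distribʳ-* _ _)) ⟩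
    (0# + r zero * ι r⁺ w₁ S) + - (r zero * ι r⁺ w₁ S)
      ≈⟨ +-congʳ (+-identityˡ _) ⟩
    r zero * ι r⁺ w₁ S + - (r zero * ι r⁺ w₁ S)
      ≈⟨ -‿inverseʳ _ ⟩
    0# ∎
    where
    r⁺ = r ∘ suc
    w₀ = w ∘ (false ∷_)
    w₁ = w ∘ (true ∷_)
  ι-square r w (true ∷ S)  = begin
    - ι (r ∘ suc) (λ S → - ι (r ∘ suc) (w ∘ (true ∷_)) S) S   ≈⟨ -‿cong (ι-negʳ (r ∘ suc) _ S) ⟩
    - (- ι (r ∘ suc) (ι (r ∘ suc) (w ∘ (true ∷_))) S)         ≈⟨ -‿involutive _ ⟩
    ι (r ∘ suc) (ι (r ∘ suc) (w ∘ (true ∷_))) S               ≈⟨ ι-square (r ∘ suc) _ S ⟩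
    0#                                                        ∎

  -- `expand` brings both orders of contraction into the same three-term shape with `p` and `q`
  -- exchanged; the remaining term is the induction hypothesis.
  ι-anticomm : ∀ {n} (r s : Row n) (w : Λ n) S → ι r (ι s w) S ≈ - ι s (ι r w) S
  ι-anticomm r s w []          = sym -0#≈0#
  ι-anticomm r s w (false ∷ S) = begin
    ι r⁺ (λ S → ι s⁺ w₀ S + s zero * w₁ S) S + r zero * (- ι s⁺ w₁ S)
      ≈⟨ expand r s ⟩
    (ι r⁺ (ι s⁺ w₀) S + p) + - q
      ≈⟨ +-congʳ (+-cong (ι-anticomm r⁺ s⁺ w₀ S) (sym (-‿involutive p))) ⟩
    (- ι s⁺ (ι r⁺ w₀) S + - (- p)) + - q
      ≈⟨ +-assoc _ _ _ ⟩
    - ι s⁺ (ι r⁺ w₀) S + (- (- p) + - q)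
      ≈⟨ +-congˡ (+-comm _ _) ⟩
    - ι s⁺ (ι r⁺ w₀) S + (- q + - (- p))
      ≈⟨ +-assoc _ _ _ ⟨
    (- ι s⁺ (ι r⁺ w₀) S + - q) + - (- p)
      ≈⟨ +-congʳ (-‿+-comm _ _) ⟩
    - (ι s⁺ (ι r⁺ w₀) S + q) + - (- p)
      ≈⟨ -‿+-comm _ _ ⟩
    - ((ι s⁺ (ι r⁺ w₀) S + q) + - p)
      ≈⟨ -‿cong (expand s r) ⟨
    - (ι s⁺ (λ S → ι r⁺ w₀ S + r zero * w₁ S) S + s zero * (- ι r⁺ w₁ S)) ∎
    where
    r⁺ = r ∘ suc
    s⁺ = s ∘ suc
    w₀ = w ∘ (false ∷_)
    w₁ = w ∘ (true ∷_)
    p = s zero * ι r⁺ w₁ S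
    q = r zero * ι s⁺ w₁ S
    expand : ∀ r s →
      ι (r ∘ suc) (λ S → ι (s ∘ suc) w₀ S + s zero * w₁ S) S + r zero * (- ι (s ∘ suc) w₁ S) ≈
      (ι (r ∘ suc) (ι (s ∘ suc) w₀) S + s zero * ι (r ∘ suc) w₁ S) + - (r zero * ι (s ∘ suc) w₁ S)
    expand r s = +-cong (trans (ι-+ʳ (r ∘ suc) _ _ S) (+-congˡ (ι-*ʳ (r ∘ suc) (s zero) w₁ S)))
                   (sym (-‿distribʳ-* _ _))
  ι-anticomm r s w (true ∷ S)  = -‿cong (begin
    ι (r ∘ suc) (λ S → - ι (s ∘ suc) w₁ S) S    ≈⟨ ι-negʳ (r ∘ suc) _ S ⟩
    - ι (r ∘ suc) (ι (s ∘ suc) w₁) S            ≈⟨ -‿cong (ι-anticomm (r ∘ suc) (s ∘ suc) w₁ S) ⟩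
    - (- ι (s ∘ suc) (ι (r ∘ suc) w₁) S)        ≈⟨ -‿cong (ι-negʳ (s ∘ suc) _ S) ⟨
    - ι (s ∘ suc) (λ S → - ι (r ∘ suc) w₁ S) S  ∎)
    where w₁ = w ∘ (true ∷_)

  -- Row zero acts first, in accordance with expansion along the first row. Since the order matters,
  -- two kinds of row operation appear below: the added row may be contracted earlier or later than
  -- the row it is added to.
  ι* : ∀ {n} l → (Fin l → Row n) → Λ n → Λ n
  ι* zero    M w = w
  ι* (suc l) M w = ι* l (M ∘ suc) (ι (M zero) w)

  ι*-cong : ∀ {n} l {M M′ : Fin l → Row n} {w w′ : Λ n} → (∀ i s → M i s ≈ M′ i s) →
    (∀ S → w S ≈ w′ S) → ∀ S → ι* l M w S ≈ ι* l M′ w′ S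
  ι*-cong zero    hM hw S = hw S
  ι*-cong (suc l) hM hw S = ι*-cong l (hM ∘ suc) (ι-cong (hM zero) hw) S

  ι*-congʳ : ∀ {n} l (M : Fin l → Row n) {w w′ : Λ n} →
    (∀ S → w S ≈ w′ S) → ∀ S → ι* l M w S ≈ ι* l M w′ S
  ι*-congʳ l M = ι*-cong l (λ i s → refl)

  ι*-+ : ∀ {n} l (M : Fin l → Row n) (w w′ : Λ n) S →
    ι* l M (λ S → w S + w′ S) S ≈ ι* l M w S + ι* l M w′ S
  ι*-+ zero    M w w′ S = refl
  ι*-+ (suc l) M w w′ S = trans (ι*-congʳ l (M ∘ suc) (ι-+ʳ (M zero) w w′) S) (ι*-+ l (M ∘ suc) _ _ S)

  ι*-* : ∀ {n} l (M : Fin l → Row n) a (w : Λ n) S → ι* l M (λ S → a * w S) S ≈ a * ι* l M w S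
  ι*-* zero    M a w S = refl
  ι*-* (suc l) M a w S = trans (ι*-congʳ l (M ∘ suc) (ι-*ʳ (M zero) a w) S) (ι*-* l (M ∘ suc) a _ S)

  ι*-0 : ∀ {n} l (M : Fin l → Row n) {w : Λ n} → (∀ S → w S ≈ 0#) → ∀ S → ι* l M w S ≈ 0#
  ι*-0 zero    M hw S = hw S
  ι*-0 (suc l) M hw S = ι*-0 l (M ∘ suc) (ι-0ʳ (M zero) hw) S

  ι*-Σ : ∀ {n} l (M : Fin l → Row n) k (a : Fin k → Carrier) (w : Fin k → Λ n) S →
    ι* l M (λ S → ΣFin k (λ j → a j * w j S)) S ≈ ΣFin k (λ j → a j * ι* l M (w j) S)
  ι*-Σ l M zero    a w S = ι*-0 l M (λ _ → refl) S
  ι*-Σ l M (suc k) a w S =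
    trans (ι*-+ l M _ _ S) (+-cong (ι*-* l M (a zero) (w zero) S) (ι*-Σ l M k (a ∘ suc) (w ∘ suc) S))

  ι*-scale : ∀ {n} l a (M : Fin l → Row n) (w : Λ n) S →
    ι* l (λ i s → a * M i s) w S ≈ (a ^ l) * ι* l M w S
  ι*-scale zero    a M w S = sym (*-identityˡ _)
  ι*-scale (suc l) a M w S = begin
    ι* l (λ i s → a * M (suc i) s) (ι (λ s → a * M zero s) w) S
      ≈⟨ ι*-scale l a (M ∘ suc) _ S ⟩
    (a ^ l) * ι* l (M ∘ suc) (ι (λ s → a * M zero s) w) S
      ≈⟨ *-congˡ (trans (ι*-congʳ l (M ∘ suc) (ι-*ˡ a (M zero) w) S) (ι*-* l (M ∘ suc) a _ S)) ⟩
    (a ^ l) * (a * ι* (suc l) M w S)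
      ≈⟨ trans (x*yz≈y*xz _ _ _) (sym (*-assoc _ _ _)) ⟩
    (a * (a ^ l)) * ι* (suc l) M w S ∎

  -- Anticommutation moves `ι s` inwards past every row of `M`, up to sign, until it meets `w`.
  ι-ι* : ∀ {n} l (M : Fin l → Row n) s (w : Λ n) → (∀ S → ι s w S ≈ 0#) → ∀ S → ι s (ι* l M w) S ≈ 0#
  ι-ι* zero    M s w h S = h S
  ι-ι* (suc l) M s w h S = ι-ι* l (M ∘ suc) s (ι (M zero) w) h′ S
    where
    h′ : ∀ S → ι s (ι (M zero) w) S ≈ 0#
    h′ S = trans (ι-anticomm s (M zero) w S) (trans (-‿cong (ι-0ʳ (M zero) h S)) -0#≈0#)

  ι-row-ι* : ∀ {n} l (M : Fin l → Row n) i (w : Λ n) S → ι (M i) (ι* l M w) S ≈ 0#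
  ι-row-ι* (suc l) M zero    w S = ι-ι* l (M ∘ suc) (M zero) _ (ι-square (M zero) w) S
  ι-row-ι* (suc l) M (suc i) w S = ι-row-ι* l (M ∘ suc) i _ S

  -- Each contraction with `T i` can be moved onto `w`, where it vanishes. If `w` is already
  -- contracted with some rows, their combinations qualify as `T i` by `ι-row-ι*`, so this adds
  -- earlier rows to later ones.
  ι*-absorbˡ : ∀ {n} l (B T : Fin l → Row n) (w : Λ n) → (∀ i S → ι (T i) w S ≈ 0#) →
    ∀ S → ι* l (λ i s → B i s + T i s) w S ≈ ι* l B w S
  ι*-absorbˡ zero    B T w h S = refl
  ι*-absorbˡ (suc l) B T w h S = begin
    ι* l (λ i s → B (suc i) s + T (suc i) s) (ι (λ s → B zero s + T zero s) w) S
      ≈⟨ ι*-congʳ l _ (λ S → trans (ι-+ˡ (B zero) (T zero) w S)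
                                (trans (+-congˡ (h zero S)) (+-identityʳ _))) S ⟩
    ι* l (λ i s → B (suc i) s + T (suc i) s) (ι (B zero) w) S
      ≈⟨ ι*-absorbˡ l (B ∘ suc) (T ∘ suc) (ι (B zero) w)
           -- The one-row case of `ι-ι*`: `T (suc i)` still annihilates after contraction with
           -- `B zero`.
           (λ i → ι-ι* 1 (λ _ → B zero) (T (suc i)) w (h (suc i))) S ⟩
    ι* l (B ∘ suc) (ι (B zero) w) S ∎

  -- The innermost contraction is moved outwards until it meets its own copy among the rows of `B`,
  -- and the square is zero. The signs are absorbed into `w`.
  ι*-ι-row : ∀ {n} l (B : Fin l → Row n) i (w : Λ n) S → ι* l B (ι (B i) w) S ≈ 0#
  ι*-ι-row (suc l) B zero    w S = ι*-0 l (B ∘ suc) (ι-square (B zero) w) S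
  ι*-ι-row (suc l) B (suc i) w S = begin
    ι* l (B ∘ suc) (ι (B zero) (ι (B (suc i)) w)) S
      ≈⟨ ι*-congʳ l (B ∘ suc) (λ S → trans (ι-anticomm (B zero) (B (suc i)) w S)
                                        (sym (ι-negʳ (B (suc i)) _ S))) S ⟩
    ι* l (B ∘ suc) (ι (B (suc i)) (λ S → - ι (B zero) w S)) S
      ≈⟨ ι*-ι-row l (B ∘ suc) i _ S ⟩
    0# ∎

  ι*-combination : ∀ {n} l (B : Fin l → Row n) (a : Fin l → Carrier) (w : Λ n) S →
    ι* l B (ι (λ s → ΣFin l (λ i → a i * B i s)) w) S ≈ 0#
  ι*-combination l B a w S = begin
    ι* l B (ι (λ s → ΣFin l (λ i → a i * B i s)) w) S         ≈⟨ ι*-congʳ l B (ι-Σˡ l a B w) S ⟩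
    ι* l B (λ S → ΣFin l (λ i → a i * ι (B i) w S)) S         ≈⟨ ι*-Σ l B l a (λ i → ι (B i) w) S ⟩
    ΣFin l (λ i → a i * ι* l B (ι (B i) w) S)                 ≈⟨ Σ-zero l (λ i → trans (*-congˡ (ι*-ι-row l B i w S)) (zeroʳ _)) ⟩
    0#                                                        ∎

  -- `ι t` is moved outwards past the rows of `A` until it stands next to `B`. Its argument changes
  -- on the way, which is why the hypothesis is quantified over all `w`.
  ι*-kill : ∀ {n} l (B : Fin l → Row n) t → (∀ w S → ι* l B (ι t w) S ≈ 0#) →
    ∀ k (A : Fin k → Row n) w S → ι* l B (ι* k A (ι t w)) S ≈ 0#
  ι*-kill l B t h zero    A w S = h w S
  ι*-kill l B t h (suc k) A w S = begin
    ι* l B (ι* k (A ∘ suc) (ι (A zero) (ι t w))) S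
      ≈⟨ ι*-congʳ l B (ι*-congʳ k (A ∘ suc) (λ S → trans (ι-anticomm (A zero) t w S) (sym (ι-negʳ t _ S)))) S ⟩
    ι* l B (ι* k (A ∘ suc) (ι t (λ S → - ι (A zero) w S))) S
      ≈⟨ ι*-kill l B t h k (A ∘ suc) _ S ⟩
    0# ∎

  -- The opposite row operation: combinations of the later rows `B` are added to the earlier rows
  -- `A`. `ι*-combination` shows that such combinations satisfy the hypothesis.
  ι*-absorbʳ : ∀ {n} l (B : Fin l → Row n) k (A T : Fin k → Row n) →
    (∀ i w S → ι* l B (ι (T i) w) S ≈ 0#) →
    ∀ w S → ι* l B (ι* k (λ i s → A i s + T i s) w) S ≈ ι* l B (ι* k A w) S
  ι*-absorbʳ l B zero    A T h w S = refl
  ι*-absorbʳ l B (suc k) A T h w S = begin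
    ι* l B (ι* k (λ i s → A (suc i) s + T (suc i) s) (ι (λ s → A zero s + T zero s) w)) S
      ≈⟨ ι*-absorbʳ l B k (A ∘ suc) (T ∘ suc) (h ∘ suc) _ S ⟩
    ι* l B (ι* k (A ∘ suc) (ι (λ s → A zero s + T zero s) w)) S
      ≈⟨ ι*-congʳ l B (λ S → trans (ι*-congʳ k (A ∘ suc) (ι-+ˡ (A zero) (T zero) w) S)
                                (ι*-+ k (A ∘ suc) _ _ S)) S ⟩
    ι* l B (λ S → ι* k (A ∘ suc) (ι (A zero) w) S + ι* k (A ∘ suc) (ι (T zero) w) S) S
      ≈⟨ ι*-+ l B _ _ S ⟩
    ι* l B (ι* k (A ∘ suc) (ι (A zero) w)) S + ι* l B (ι* k (A ∘ suc) (ι (T zero) w)) S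
      ≈⟨ +-congˡ (ι*-kill l B (T zero) (h zero) k (A ∘ suc) w S) ⟩
    ι* l B (ι* k (A ∘ suc) (ι (A zero) w)) S + 0#
      ≈⟨ +-identityʳ _ ⟩
    ι* l B (ι* (suc k) A w) S ∎

  top : ∀ {n} → Λ n
  top []          = 1#
  top (false ∷ S) = 0#
  top (true  ∷ S) = top S

  scalarPart : ∀ {n} → Λ n → Carrier
  scalarPart {n} w = w (replicate n false)

  -- The inclusion of exterior algebras induced by `punchIn j`: the image is supported on the sets
  -- omitting j. Contractions of it see every column except j, exactly as a minor does.
  embed : ∀ {n} → Fin (suc n) → Λ n → Λ (suc n)
  embed zero            w (false ∷ S) = w S
  embed zero            w (true  ∷ S) = 0#
  embed {suc n} (suc j) w (b ∷ S)     = embed j (w ∘ (b ∷_)) S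

  embed-0 : ∀ {n} j S → embed {n} j (λ _ → 0#) S ≈ 0#
  embed-0 zero            (false ∷ S) = refl
  embed-0 zero            (true  ∷ S) = refl
  embed-0 {suc n} (suc j) (b ∷ S)     = embed-0 j S

  embed-+* : ∀ {n} j (w : Λ n) a w′ S →
    embed j (λ S → w S + a * w′ S) S ≈ embed j w S + a * embed j w′ S
  embed-+* zero            w a w′ (false ∷ S) = refl
  embed-+* zero            w a w′ (true  ∷ S) = sym (trans (+-identityˡ _) (zeroʳ a))
  embed-+* {suc n} (suc j) w a w′ (b ∷ S)     = embed-+* j _ a _ S

  embed-neg : ∀ {n} j (w : Λ n) S → embed j (λ S → - w S) S ≈ - embed j w S
  embed-neg zero            w (false ∷ S) = refl
  embed-neg zero            w (true  ∷ S) = sym -0#≈0#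
  embed-neg {suc n} (suc j) w (b ∷ S)     = embed-neg j _ S

  scalarPart-embed : ∀ {n} j (w : Λ n) → scalarPart (embed j w) ≈ scalarPart w
  scalarPart-embed zero            w = refl
  scalarPart-embed {suc n} (suc j) w = scalarPart-embed j _

  ι-embed : ∀ {n} j (r : Row (suc n)) (w : Λ n) S → ι r (embed j w) S ≈ embed j (ι (r ∘ punchIn j) w) S
  ι-embed zero            r w (false ∷ S) = trans (+-congˡ (zeroʳ _)) (+-identityʳ _)
  ι-embed zero            r w (true  ∷ S) = trans (-‿cong (ι-0ʳ _ (λ _ → refl) S)) -0#≈0#
  ι-embed {suc n} (suc j) r w (false ∷ S) =
    trans (+-congʳ (ι-embed j (r ∘ suc) _ S)) (sym (embed-+* j _ (r zero) _ S))
  ι-embed {suc n} (suc j) r w (true  ∷ S) =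
    trans (-‿cong (ι-embed j (r ∘ suc) _ S)) (sym (embed-neg j _ S))

  ι*-embed : ∀ {n} l j (M : Fin l → Row (suc n)) (w : Λ n) S →
    ι* l M (embed j w) S ≈ embed j (ι* l (λ i → M i ∘ punchIn j) w) S
  ι*-embed zero    j M w S = refl
  ι*-embed (suc l) j M w S =
    trans (ι*-congʳ l (M ∘ suc) (ι-embed j (M zero) w) S) (ι*-embed l j (M ∘ suc) _ S)

  -- Removing e_j from the full wedge passes j basis vectors, which produces the alternating sign of
  -- the Laplace expansion.
  ι-top : ∀ {n} (r : Row (suc n)) S →
    ι r top S ≈ ΣFin (suc n) (λ j → (sgn (toℕ j) * r j) * embed j top S)
  ι-top {n} r (false ∷ S) = begin
    ι (r ∘ suc) (λ _ → 0#) S + r zero * top S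
      ≈⟨ +-cong (ι-0ʳ _ (λ _ → refl) S) (*-congʳ (sym (*-identityˡ _))) ⟩
    0# + (1# * r zero) * top S
      ≈⟨ +-comm _ _ ⟩
    (1# * r zero) * top S + 0#
      -- On a set lacking the first basis vector only the summand that removes this vector is
      -- nonzero.
      ≈⟨ +-congˡ (Σ-zero n (λ j → trans (*-congˡ (vanish j S)) (zeroʳ _))) ⟨
    ΣFin (suc n) (λ j → (sgn (toℕ j) * r j) * embed j top (false ∷ S)) ∎
    where
    vanish : ∀ {n} (j : Fin n) S → embed (suc j) top (false ∷ S) ≈ 0#
    vanish {suc n} j S = embed-0 j S
  ι-top {zero} r (true ∷ []) =
    trans -0#≈0# (sym (trans (+-identityʳ _) (zeroʳ _)))
  ι-top {suc n} r (true ∷ S) = begin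
    - ι (r ∘ suc) top S
      ≈⟨ -‿cong (ι-top (r ∘ suc) S) ⟩
    - ΣFin (suc n) term
      ≈⟨ -1*x≈-x _ ⟨
    - 1# * ΣFin (suc n) term
      ≈⟨ Σ-*ˡ (suc n) (- 1#) term ⟨
    ΣFin (suc n) (λ j → - 1# * term j)
      ≈⟨ Σ-cong (suc n) negate ⟩
    ΣFin (suc n) (λ j → (- sgn (toℕ j) * r (suc j)) * embed j top S)
      ≈⟨ trans (+-congʳ (zeroʳ _)) (+-identityˡ _) ⟨
    ΣFin (suc (suc n)) (λ j → (sgn (toℕ j) * r j) * embed j top (true ∷ S)) ∎
    where
    term : Fin (suc n) → Carrier
    term j = (sgn (toℕ j) * r (suc j)) * embed j top S
    negate : ∀ j → - 1# * term j ≈ (- sgn (toℕ j) * r (suc j)) * embed j top S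
    negate j = begin
      - 1# * term j                                     ≈⟨ -1*x≈-x _ ⟩
      - ((sgn (toℕ j) * r (suc j)) * embed j top S)     ≈⟨ -‿distribˡ-* _ _ ⟩
      (- (sgn (toℕ j) * r (suc j))) * embed j top S     ≈⟨ *-congʳ (-‿distribˡ-* _ _) ⟩
      (- sgn (toℕ j) * r (suc j)) * embed j top S       ∎

  -- Contracting `top` with row zero gives the Laplace coefficients by `ι-top`; the other rows turn
  -- each `embed j top` into the minor without column j by `ι*-embed`.
  det-contraction : ∀ n (M : Mat n) → det n M ≈ scalarPart (ι* n M top)
  det-contraction zero    M = refl
  det-contraction (suc n) M = begin
    ΣFin (suc n) (λ j → (sgn (toℕ j) * M zero j) * det n (λ r s → M (suc r) (punchIn j s)))
      ≈⟨ Σ-cong (suc n) (λ j → *-congˡ {sgn (toℕ j) * M zero j} (trans (det-contraction n _)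
           (trans (sym (scalarPart-embed j _)) (sym (ι*-embed n j (M ∘ suc) top _))))) ⟩
    ΣFin (suc n) (λ j → (sgn (toℕ j) * M zero j) * scalarPart (ι* n (M ∘ suc) (embed j top)))
      ≈⟨ ι*-Σ n (M ∘ suc) (suc n) (λ j → sgn (toℕ j) * M zero j) (λ j → embed j top) _ ⟨
    scalarPart (ι* n (M ∘ suc) (λ S → ΣFin (suc n) (λ j → (sgn (toℕ j) * M zero j) * embed j top S)))
      ≈⟨ ι*-congʳ n (M ∘ suc) (ι-top (M zero)) _ ⟨
    scalarPart (ι* (suc n) M top) ∎

  det-cong : ∀ n {M M′ : Mat n} → (∀ i j → M i j ≈ M′ i j) → det n M ≈ det n M′
  det-cong n {M} {M′} h = trans (det-contraction n M)
    (trans (ι*-cong n h (λ _ → refl) _) (sym (det-contraction n M′)))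

  -- The derivative of t ↦ ι* l (N + t X) w at t = 0.
  Dι* : ∀ {n} l → (N X : Fin l → Row n) → Λ n → Λ n
  Dι* zero    N X w S = 0#
  Dι* (suc l) N X w S = ι* l (N ∘ suc) (ι (X zero) w) S + Dι* l (N ∘ suc) (X ∘ suc) (ι (N zero) w) S

  Dι*-cong : ∀ {n} l {N N′ X X′ : Fin l → Row n} {w w′ : Λ n} → (∀ i s → N i s ≈ N′ i s) →
    (∀ i s → X i s ≈ X′ i s) → (∀ S → w S ≈ w′ S) → ∀ S → Dι* l N X w S ≈ Dι* l N′ X′ w′ S
  Dι*-cong zero    hN hX hw S = refl
  Dι*-cong (suc l) hN hX hw S =
    +-cong (ι*-cong l (hN ∘ suc) (ι-cong (hX zero) hw) S)
           (Dι*-cong l (hN ∘ suc) (hX ∘ suc) (ι-cong (hN zero) hw) S)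

  Dι*-+ : ∀ {n} l (N X X′ : Fin l → Row n) (w : Λ n) S →
    Dι* l N (λ i s → X i s + X′ i s) w S ≈ Dι* l N X w S + Dι* l N X′ w S
  Dι*-+ zero    N X X′ w S = sym (+-identityˡ 0#)
  Dι*-+ (suc l) N X X′ w S = trans
    (+-cong (trans (ι*-congʳ l (N ∘ suc) (ι-+ˡ (X zero) (X′ zero) w) S) (ι*-+ l (N ∘ suc) _ _ S))
            (Dι*-+ l (N ∘ suc) (X ∘ suc) (X′ ∘ suc) _ S))
    (interchange _ _ _ _)

  Dι*-* : ∀ {n} l (N : Fin l → Row n) a X (w : Λ n) S →
    Dι* l N (λ i s → a * X i s) w S ≈ a * Dι* l N X w S
  Dι*-* zero    N a X w S = sym (zeroʳ a)
  Dι*-* (suc l) N a X w S = trans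
    (+-cong (trans (ι*-congʳ l (N ∘ suc) (ι-*ˡ a (X zero) w) S) (ι*-* l (N ∘ suc) a _ S))
            (Dι*-* l (N ∘ suc) a (X ∘ suc) _ S))
    (sym (distribˡ a _ _))

  Dι*-0 : ∀ {n} l (N : Fin l → Row n) (w : Λ n) S → Dι* l N (λ _ _ → 0#) w S ≈ 0#
  Dι*-0 l N w S = trans (Dι*-cong l (λ _ _ → refl) (λ _ _ → sym (zeroˡ 0#)) (λ _ → refl) S)
                    (trans (Dι*-* l N 0# (λ _ _ → 0#) w S) (zeroˡ _))

  -- A rank-one perturbation is affine: a second contraction with v gives 0.
  ι*-rank-one : ∀ {n} l (N : Fin l → Row n) (u : Fin l → Carrier) (v : Row n) (w : Λ n) S →
    ι* l (λ i s → N i s + u i * v s) w S ≈ ι* l N w S + Dι* l N (λ i s → u i * v s) w S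
  ι*-rank-one zero    N u v w S = sym (+-identityʳ _)
  ι*-rank-one (suc l) N u v w S = begin
    ι* l N⁺ᵘ (ι (λ s → N zero s + u zero * v s) w) S
      ≈⟨ trans (ι*-congʳ l N⁺ᵘ (ι-+ˡ (N zero) uv w) S) (ι*-+ l N⁺ᵘ _ _ S) ⟩
    ι* l N⁺ᵘ (ι (N zero) w) S + ι* l N⁺ᵘ (ι uv w) S
      ≈⟨ +-cong (ι*-rank-one l (N ∘ suc) (u ∘ suc) v _ S) (ι*-absorbˡ l (N ∘ suc) _ _ kill S) ⟩
    (ι* l (N ∘ suc) (ι (N zero) w) S + Dι* l (N ∘ suc) (λ i s → u (suc i) * v s) (ι (N zero) w) S)
      + ι* l (N ∘ suc) (ι uv w) S
      ≈⟨ trans (+-assoc _ _ _) (+-congˡ (+-comm _ _)) ⟩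
    ι* (suc l) N w S + Dι* (suc l) N (λ i s → u i * v s) w S ∎
    where
    uv : Row _
    uv s = u zero * v s
    N⁺ᵘ : Fin l → Row _
    N⁺ᵘ i s = N (suc i) s + u (suc i) * v s
    kill : ∀ i S → ι (λ s → u (suc i) * v s) (ι uv w) S ≈ 0#
    kill i S = begin
      ι (λ s → u (suc i) * v s) (ι uv w) S             ≈⟨ ι-*ˡ (u (suc i)) v (ι uv w) S ⟩
      u (suc i) * ι v (ι uv w) S                       ≈⟨ *-congˡ (ι-cong (λ _ → refl) (ι-*ˡ (u zero) v w) S) ⟩
      u (suc i) * ι v (λ S → u zero * ι v w S) S       ≈⟨ *-congˡ (ι-*ʳ v (u zero) (ι v w) S) ⟩
      u (suc i) * (u zero * ι v (ι v w) S)             ≈⟨ *-congˡ (*-congˡ (ι-square v w S)) ⟩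
      u (suc i) * (u zero * 0#)                        ≈⟨ trans (*-congˡ (zeroʳ _)) (zeroʳ _) ⟩
      0#                                               ∎

  -- Jacobi's tr (adj N · X), in a form whose linearity in `X` follows row by row.
  Ddet : ∀ n → Mat n → Mat n → Carrier
  Ddet n N X = scalarPart (Dι* n N X top)

  Ddet-cong : ∀ n {N N′ X X′ : Mat n} → (∀ a b → N a b ≈ N′ a b) → (∀ a b → X a b ≈ X′ a b) →
    Ddet n N X ≈ Ddet n N′ X′
  Ddet-cong n hN hX = Dι*-cong n hN hX (λ _ → refl) _

  Ddet-* : ∀ n (N : Mat n) a (X : Mat n) → Ddet n N (λ i s → a * X i s) ≈ a * Ddet n N X
  Ddet-* n N a X = Dι*-* n N a X top _

  Ddet-Σ : ∀ n (N : Mat n) k (X : Fin k → Mat n) →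
    Ddet n N (λ a b → ΣFin k (λ j → X j a b)) ≈ ΣFin k (λ j → Ddet n N (X j))
  Ddet-Σ n N zero    X = Dι*-0 n N top _
  Ddet-Σ n N (suc k) X = trans (Dι*-+ n N (X zero) _ top _) (+-congˡ (Ddet-Σ n N k (X ∘ suc)))

  det-rank-one : ∀ n (N : Mat n) (u v : Row n) →
    det n (λ a b → N a b + u a * v b) ≈ det n N + Ddet n N (λ a b → u a * v b)
  det-rank-one n N u v = trans (det-contraction n _)
    (trans (ι*-rank-one n N u v top _) (+-congʳ (sym (det-contraction n N))))

-- Concatenation of finite families

module Concatenation where

  -- Recursion on `m` makes the first entry of a nonempty left part compute, so block matrices can
  -- be peeled one row or column at a time.
  cat : ∀ {a} {A : Set a} m {n} → (Fin m → A) → (Fin n → A) → Fin (m ℕ.+ n) → A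
  cat zero    f g i       = g i
  cat (suc m) f g zero    = f zero
  cat (suc m) f g (suc i) = cat m (f ∘ suc) g i

  cat-↑ˡ : ∀ {a} {A : Set a} m {n} (f : Fin m → A) (g : Fin n → A) i → cat m f g (i ↑ˡ n) ≡ f i
  cat-↑ˡ (suc m) f g zero    = ≡.refl
  cat-↑ˡ (suc m) f g (suc i) = cat-↑ˡ m (f ∘ suc) g i

  cat-↑ʳ : ∀ {a} {A : Set a} m {n} (f : Fin m → A) (g : Fin n → A) j → cat m f g (m ↑ʳ j) ≡ g j
  cat-↑ʳ zero    f g j = ≡.refl
  cat-↑ʳ (suc m) f g j = cat-↑ʳ m (f ∘ suc) g j

  ↑-elim : ∀ {p} m {n} (P : Fin (m ℕ.+ n) → Set p) →
    (∀ i → P (i ↑ˡ n)) → (∀ j → P (m ↑ʳ j)) → ∀ s → P s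
  ↑-elim zero    P hˡ hʳ s       = hʳ s
  ↑-elim (suc m) P hˡ hʳ zero    = hˡ zero
  ↑-elim (suc m) P hˡ hʳ (suc s) = ↑-elim m (P ∘ suc) (hˡ ∘ suc) hʳ s

  cat-all : ∀ {a p} {A : Set a} (P : A → Set p) m {n} (f : Fin m → A) (g : Fin n → A) →
    (∀ i → P (f i)) → (∀ j → P (g j)) → ∀ s → P (cat m f g s)
  cat-all P zero    f g hf hg s       = hg s
  cat-all P (suc m) f g hf hg zero    = hf zero
  cat-all P (suc m) f g hf hg (suc s) = cat-all P m (f ∘ suc) g (hf ∘ suc) hg s

  -- The two families may have different types, so block rows of different widths can be compared,
  -- as happens when a column is deleted.
  cat-rel : ∀ {a b r} {A : Set a} {B : Set b} (R : A → B → Set r) m {n}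
    (f : Fin m → A) (g : Fin n → A) (f′ : Fin m → B) (g′ : Fin n → B) →
    (∀ i → R (f i) (f′ i)) → (∀ j → R (g j) (g′ j)) → ∀ s → R (cat m f g s) (cat m f′ g′ s)
  cat-rel R zero    f g f′ g′ hf hg s       = hg s
  cat-rel R (suc m) f g f′ g′ hf hg zero    = hf zero
  cat-rel R (suc m) f g f′ g′ hf hg (suc s) = cat-rel R m (f ∘ suc) g (f′ ∘ suc) g′ (hf ∘ suc) hg s

  cat-punchIn : ∀ {a} {A : Set a} m {n} (f : Fin (suc m) → A) (g : Fin n → A) j s →
    cat (suc m) f g (punchIn (j ↑ˡ n) s) ≡ cat m (f ∘ punchIn j) g s
  cat-punchIn m       f g zero    s       = ≡.refl
  cat-punchIn (suc m) f g (suc j) zero    = ≡.refl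
  cat-punchIn (suc m) f g (suc j) (suc s) = cat-punchIn m (f ∘ suc) g j s

-- Block determinants and Sylvester's identity

module BlockDeterminants {c ℓ} (R : CommutativeRing c ℓ) where
  open CommutativeRing R hiding (zero)
  open RawOps rawRing
  open FiniteSums R
  open Contraction R
  open Concatenation
  open RingProperties ring using (-‿distribˡ-*; -‿distribʳ-*; -‿involutive)
  open SetoidReasoning setoid

  block : ∀ m {n} → Mat m → (Fin m → Row n) → (Fin n → Row m) → Mat n → Mat (m ℕ.+ n)
  block m A B C D = cat m (λ i → cat m (A i) (B i)) (λ i → cat m (C i) (D i))

  ι*-cat : ∀ {n} k l (A : Fin k → Row n) (B : Fin l → Row n) w S →
    ι* (k ℕ.+ l) (cat k A B) w S ≈ ι* l B (ι* k A w) S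
  ι*-cat zero    l A B w S = refl
  ι*-cat (suc k) l A B w S = ι*-cat k l (A ∘ suc) B (ι (A zero) w) S

  -- With column zero empty, no row carries a coefficient from a set containing the first basis
  -- vector to a set lacking it.
  ι*-first-column : ∀ {n} l (M : Fin l → Row (suc n)) w → (∀ i → M i zero ≈ 0#) → ∀ S →
    ι* l M w (false ∷ S) ≈ ι* l (λ i → M i ∘ suc) (w ∘ (false ∷_)) S
  ι*-first-column zero    M w h S = refl
  ι*-first-column (suc l) M w h S = trans (ι*-first-column l (M ∘ suc) (ι (M zero) w) (h ∘ suc) S)
    (ι*-congʳ l _ (λ S → trans (+-congˡ (trans (*-congʳ (h zero)) (zeroˡ _))) (+-identityʳ _)) S)

  det-first-column : ∀ n (M : Mat (suc n)) → (∀ i → M (suc i) zero ≈ 0#) →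
    det (suc n) M ≈ M zero zero * det n (λ i j → M (suc i) (suc j))
  det-first-column n M h = begin
    det (suc n) M
      ≈⟨ det-contraction (suc n) M ⟩
    scalarPart (ι* n (M ∘ suc) (ι (M zero) top))
      ≈⟨ ι*-first-column n (M ∘ suc) (ι (M zero) top) h _ ⟩
    scalarPart (ι* n M₁₁ (λ S → ι (M zero) top (false ∷ S)))
      -- `top` vanishes on sets lacking the first basis vector, so only the corner entry
      -- contributes.
      ≈⟨ ι*-congʳ n M₁₁ (λ S → trans (+-congʳ (ι-0ʳ _ (λ _ → refl) S)) (+-identityˡ _)) _ ⟩
    scalarPart (ι* n M₁₁ (λ S → M zero zero * top S))
      ≈⟨ ι*-* n M₁₁ (M zero zero) top _ ⟩
    M zero zero * scalarPart (ι* n M₁₁ top)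
      ≈⟨ *-congˡ (det-contraction n M₁₁) ⟨
    M zero zero * det n M₁₁ ∎
    where
    M₁₁ : Mat n
    M₁₁ i j = M (suc i) (suc j)

  det-scalar : ∀ n x → det n (λ i j → x * kronecker i j) ≈ x ^ n
  det-scalar zero    x = refl
  det-scalar (suc n) x = trans (det-first-column n (λ i j → x * kronecker i j) (λ i → zeroʳ x))
                           (*-cong (*-identityʳ x) (det-scalar n x))

  det-block-unitriangular : ∀ m {n} (V : Fin m → Row n) (W : Mat n) →
    det (m ℕ.+ n) (block m kronecker V (λ _ _ → 0#) W) ≈ det n W
  det-block-unitriangular zero    V W = refl
  det-block-unitriangular (suc m) {n} V W = begin
    det (suc m ℕ.+ n) M
      ≈⟨ det-first-column (m ℕ.+ n) M
           (cat-all (λ r → r zero ≈ 0#) m (M₁ ∘ suc) M₂ (λ _ → refl) (λ _ → refl)) ⟩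
    1# * det (m ℕ.+ n) (λ i j → M (suc i) (suc j))
      ≈⟨ *-identityˡ _ ⟩
    det (m ℕ.+ n) (λ i j → M (suc i) (suc j))
      ≈⟨ det-cong (m ℕ.+ n) (cat-rel (λ r r′ → ∀ s → r (suc s) ≈ r′ s) m (M₁ ∘ suc) M₂
           (λ i → cat m (kronecker i) (V (suc i))) (λ i → cat m (λ _ → 0#) (W i))
           (λ _ _ → refl) (λ _ _ → refl)) ⟩
    det (m ℕ.+ n) (block m kronecker (V ∘ suc) (λ _ _ → 0#) W)
      ≈⟨ det-block-unitriangular m (V ∘ suc) W ⟩
    det n W ∎
    where
    M₁ : Fin (suc m) → Row (suc m ℕ.+ n)
    M₁ i = cat (suc m) (kronecker i) (V i)
    M₂ : Fin n → Row (suc m ℕ.+ n)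
    M₂ i = cat (suc m) (λ _ → 0#) (W i)
    M : Mat (suc m ℕ.+ n)
    M = cat (suc m) M₁ M₂

  -- Expansion along row zero stays inside `P`: the right part of that row is zero, and deleting a
  -- left column preserves the block shape.
  det-block-triangular : ∀ m {n} (P : Mat m) (Q : Fin n → Row m) (W : Mat n) →
    det (m ℕ.+ n) (block m P (λ _ _ → 0#) Q W) ≈ det m P * det n W
  det-block-triangular zero    P Q W = sym (*-identityˡ _)
  det-block-triangular (suc m) {n} P Q W = begin
    det (suc m ℕ.+ n) M
      ≈⟨ Σ-split (suc m) n (λ j → (sgn (toℕ j) * M zero j) * minor j) ⟩
    ΣFin (suc m) (λ j → (sgn (toℕ (j ↑ˡ n)) * M zero (j ↑ˡ n)) * minor (j ↑ˡ n))
      + ΣFin n (λ i → (sgn (toℕ (suc m ↑ʳ i)) * M zero (suc m ↑ʳ i)) * minor (suc m ↑ʳ i))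
      ≈⟨ +-cong (Σ-cong (suc m) left) (Σ-zero n right) ⟩
    ΣFin (suc m) (λ j → det n W * term j) + 0#
      ≈⟨ +-identityʳ _ ⟩
    ΣFin (suc m) (λ j → det n W * term j)
      ≈⟨ Σ-*ˡ (suc m) (det n W) term ⟩
    det n W * det (suc m) P
      ≈⟨ *-comm _ _ ⟩
    det (suc m) P * det n W ∎
    where
    M : Mat (suc m ℕ.+ n)
    M = block (suc m) P (λ _ _ → 0#) Q W
    minor : Fin (suc m ℕ.+ n) → Carrier
    minor j = det (m ℕ.+ n) (λ r s → M (suc r) (punchIn j s))
    term : Fin (suc m) → Carrier
    term j = (sgn (toℕ j) * P zero j) * det m (λ r s → P (suc r) (punchIn j s))
    minor-left : ∀ j → minor (j ↑ˡ n) ≈ det m (λ r s → P (suc r) (punchIn j s)) * det n W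
    minor-left j = trans
      (det-cong (m ℕ.+ n) (cat-rel (λ r r′ → ∀ s → r (punchIn (j ↑ˡ n) s) ≈ r′ s) m
        (λ p → cat (suc m) (P (suc p)) (λ _ → 0#)) (λ i → cat (suc m) (Q i) (W i))
        (λ p → cat m (P (suc p) ∘ punchIn j) (λ _ → 0#)) (λ i → cat m (Q i ∘ punchIn j) (W i))
        (λ p s → reflexive (cat-punchIn m (P (suc p)) (λ _ → 0#) j s))
        (λ i s → reflexive (cat-punchIn m (Q i) (W i) j s))))
      (det-block-triangular m (λ r s → P (suc r) (punchIn j s)) (λ i → Q i ∘ punchIn j) W)
    left : ∀ j → (sgn (toℕ (j ↑ˡ n)) * M zero (j ↑ˡ n)) * minor (j ↑ˡ n) ≈ det n W * term j
    left j = begin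
      (sgn (toℕ (j ↑ˡ n)) * M zero (j ↑ˡ n)) * minor (j ↑ˡ n)
        ≈⟨ *-cong (*-cong (reflexive (≡.cong sgn (toℕ-↑ˡ j n)))
                          (reflexive (cat-↑ˡ (suc m) (P zero) _ j))) (minor-left j) ⟩
      (sgn (toℕ j) * P zero j) * (det m (λ r s → P (suc r) (punchIn j s)) * det n W)
        ≈⟨ *-assoc _ _ _ ⟨
      term j * det n W
        ≈⟨ *-comm _ _ ⟩
      det n W * term j ∎
    right : ∀ i → (sgn (toℕ (suc m ↑ʳ i)) * M zero (suc m ↑ʳ i)) * minor (suc m ↑ʳ i) ≈ 0#
    right i = begin
      (sgn (toℕ (suc m ↑ʳ i)) * M zero (suc m ↑ʳ i)) * minor (suc m ↑ʳ i)
        ≈⟨ *-congʳ (*-congˡ (reflexive (cat-↑ʳ (suc m) (P zero) (λ _ → 0#) i))) ⟩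
      (sgn (toℕ (suc m ↑ʳ i)) * 0#) * minor (suc m ↑ʳ i)
        ≈⟨ trans (*-congʳ (zeroʳ _)) (zeroˡ _) ⟩
      0# ∎

  det-block-ι* : ∀ m n (A : Fin m → Row (m ℕ.+ n)) (B : Fin n → Row (m ℕ.+ n)) →
    det (m ℕ.+ n) (cat m A B) ≈ scalarPart (ι* n B (ι* m A top))
  det-block-ι* m n A B = trans (det-contraction (m ℕ.+ n) _) (ι*-cat m n A B top _)

  module _ (m n : ℕ) (x : Carrier) (U : Fin n → Row m) (V : Fin m → Row n) where

    private
      -- The rows of (I | V); below them `B` holds the rows of (-U | x I). Eliminating either block
      -- of this one matrix produces one side of Sylvester's identity.
      T : Fin m → Row (m ℕ.+ n)
      T p = cat m (kronecker p) (V p)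

      B : Fin n → Row (m ℕ.+ n)
      B a = cat m (λ p → - U a p) (λ b → x * kronecker a b)

    -- Adding Σ_p U a p · T p to `B a` clears the left block and leaves x I + U V on the right. The
    -- rows of `T` are contracted first, so `ι*-absorbˡ` applies.
    schur : det n (λ a b → x * kronecker a b + ΣFin m (λ p → U a p * V p b)) ≈
            det (m ℕ.+ n) (cat m T B)
    schur = begin
      det n W
        ≈⟨ det-block-unitriangular m V W ⟨
      det (m ℕ.+ n) (block m kronecker V (λ _ _ → 0#) W)
        ≈⟨ det-block-ι* m n T _ ⟩
      scalarPart (ι* n (λ a → cat m (λ _ → 0#) (W a)) (ι* m T top))
        ≈⟨ ι*-cong n entry (λ _ → refl) _ ⟩
      scalarPart (ι* n (λ a s → B a s + ΣFin m (λ p → U a p * T p s)) (ι* m T top))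
        ≈⟨ ι*-absorbˡ n B _ (ι* m T top) kill _ ⟩
      scalarPart (ι* n B (ι* m T top))
        ≈⟨ det-block-ι* m n T B ⟨
      det (m ℕ.+ n) (cat m T B) ∎
      where
      W : Mat n
      W a b = x * kronecker a b + ΣFin m (λ p → U a p * V p b)
      kill : ∀ a S → ι (λ s → ΣFin m (λ p → U a p * T p s)) (ι* m T top) S ≈ 0#
      kill a S = trans (ι-Σˡ m (U a) T _ S)
        (Σ-zero m (λ p → trans (*-congˡ (ι-row-ι* m T p top S)) (zeroʳ _)))
      entry : ∀ a s → cat m (λ _ → 0#) (W a) s ≈ B a s + ΣFin m (λ p → U a p * T p s)
      entry a = ↑-elim m _
        (λ j → begin
          cat m (λ _ → 0#) (W a) (j ↑ˡ n)
            ≈⟨ reflexive (cat-↑ˡ m _ (W a) j) ⟩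
          0#
            ≈⟨ -‿inverseˡ (U a j) ⟨
          - U a j + U a j
            ≈⟨ +-congˡ (Σ-kronecker m (U a) j) ⟨
          - U a j + ΣFin m (λ p → U a p * kronecker p j)
            ≈⟨ +-cong (reflexive (cat-↑ˡ m _ _ j))
                      (Σ-cong m (λ p → *-congˡ (reflexive (cat-↑ˡ m (kronecker p) (V p) j)))) ⟨
          B a (j ↑ˡ n) + ΣFin m (λ p → U a p * T p (j ↑ˡ n)) ∎)
        (λ b → trans (reflexive (cat-↑ʳ m _ (W a) b))
          (sym (+-cong (reflexive (cat-↑ʳ m _ _ b))
                       (Σ-cong m (λ p → *-congˡ (reflexive (cat-↑ʳ m (kronecker p) (V p) b)))))))

    -- Elimination in the other direction: x T_p - Σ_a V p a · B_a is (x I + V U | 0). Scaling the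
    -- rows of `T` by x avoids dividing by x and costs the factor x^m. Now later rows are added to
    -- earlier ones, which is `ι*-absorbʳ`.
    schur-scaled : (x ^ m) * det (m ℕ.+ n) (cat m T B) ≈
      (x ^ n) * det m (λ p q → x * kronecker p q + ΣFin n (λ a → V p a * U a q))
    schur-scaled = begin
      (x ^ m) * det (m ℕ.+ n) (cat m T B)
        ≈⟨ *-congˡ (det-block-ι* m n T B) ⟩
      (x ^ m) * scalarPart (ι* n B (ι* m T top))
        ≈⟨ trans (ι*-congʳ n B (ι*-scale m x T top) _) (ι*-* n B (x ^ m) _ _) ⟨
      scalarPart (ι* n B (ι* m (λ p s → x * T p s) top))
        ≈⟨ ι*-absorbʳ n B m _ _ (λ p → ι*-combination n B (λ a → - V p a)) top _ ⟨
      scalarPart (ι* n B (ι* m (λ p s → x * T p s + ΣFin n (λ a → - V p a * B a s)) top))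
        ≈⟨ ι*-congʳ n B (ι*-cong m entry (λ _ → refl)) _ ⟩
      scalarPart (ι* n B (ι* m (λ p → cat m (W p) (λ _ → 0#)) top))
        ≈⟨ det-block-ι* m n _ B ⟨
      det (m ℕ.+ n) (block m W (λ _ _ → 0#) (λ a p → - U a p) (λ a b → x * kronecker a b))
        ≈⟨ det-block-triangular m W _ _ ⟩
      det m W * det n (λ a b → x * kronecker a b)
        ≈⟨ trans (*-comm _ _) (*-congʳ (det-scalar n x)) ⟩
      (x ^ n) * det m W ∎
      where
      W : Mat m
      W p q = x * kronecker p q + ΣFin n (λ a → V p a * U a q)
      neg*neg : ∀ y z → - y * - z ≈ y * z
      neg*neg y z = trans (sym (-‿distribˡ-* y (- z)))
        (trans (-‿cong (sym (-‿distribʳ-* y z))) (-‿involutive _))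
      entry : ∀ p s → x * T p s + ΣFin n (λ a → - V p a * B a s) ≈ cat m (W p) (λ _ → 0#) s
      entry p = ↑-elim m _
        (λ j → trans
          (+-cong (*-congˡ (reflexive (cat-↑ˡ m (kronecker p) (V p) j)))
                  (Σ-cong n (λ a → trans (*-congˡ (reflexive (cat-↑ˡ m _ _ j))) (neg*neg _ _))))
          (sym (reflexive (cat-↑ˡ m (W p) _ j))))
        (λ b → begin
          x * T p (m ↑ʳ b) + ΣFin n (λ a → - V p a * B a (m ↑ʳ b))
            ≈⟨ +-cong (*-congˡ (reflexive (cat-↑ʳ m (kronecker p) (V p) b)))
                      (Σ-cong n (λ a → *-congˡ (reflexive (cat-↑ʳ m _ _ b)))) ⟩
          x * V p b + ΣFin n (λ a → - V p a * (x * kronecker a b))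
            ≈⟨ +-congˡ (Σ-cong n (λ a → sym (*-assoc (- V p a) x _))) ⟩
          x * V p b + ΣFin n (λ a → (- V p a * x) * kronecker a b)
            ≈⟨ +-congˡ (Σ-kronecker n (λ a → - V p a * x) b) ⟩
          x * V p b + - V p b * x
            ≈⟨ +-cong (*-comm _ _) (sym (-‿distribˡ-* _ _)) ⟩
          V p b * x + - (V p b * x)
            ≈⟨ -‿inverseʳ _ ⟩
          0#
            ≈⟨ reflexive (cat-↑ʳ m (W p) (λ _ → 0#) b) ⟨
          cat m (W p) (λ _ → 0#) (m ↑ʳ b) ∎)

    sylvester :
      (x ^ m) * det n (λ a b → x * kronecker a b + ΣFin m (λ p → U a p * V p b)) ≈
      (x ^ n) * det m (λ p q → x * kronecker p q + ΣFin n (λ a → V p a * U a q))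
    sylvester = trans (*-congˡ schur) schur-scaled

-- First-order Taylor coefficients of the determinant of a polynomial matrix

module DeterminantDerivative {c ℓ} (R : CommutativeRing c ℓ) where
  open CommutativeRing R hiding (zero)
  open PolyDef rawRing
  open PolynomialRing R
  open RawOps rawRing
  open RingProperties ring using (-0#≈0#; -‿+-comm)
  open CommutativeSemigroupProperties +-commutativeSemigroup using (interchange)
  open SetoidReasoning setoid
  open Contraction R
  private module ΛP = Contraction (toCR (Poly rawRing) isCR)

  coeff₀-ι : ∀ {n} (r : ΛP.Row n) (w : ΛP.Λ n) S →
    coeff (ΛP.ι r w S) 0 ≈ ι (λ i → coeff (r i) 0) (λ S → coeff (w S) 0) S
  coeff₀-ι r w []          = refl
  coeff₀-ι r w (false ∷ S) = trans (coeff-+ (ΛP.ι (r ∘ suc) (w ∘ (false ∷_)) S) _ 0)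
    (+-cong (coeff₀-ι (r ∘ suc) _ S) (coeff₀-* (r zero) (w (true ∷ S))))
  coeff₀-ι r w (true ∷ S)  = trans (coeff-neg (ΛP.ι (r ∘ suc) (w ∘ (true ∷_)) S) 0)
    (-‿cong (coeff₀-ι (r ∘ suc) _ S))

  coeff₁-ι : ∀ {n} (r : ΛP.Row n) (w : ΛP.Λ n) S → coeff (ΛP.ι r w S) 1 ≈
    ι (λ i → coeff (r i) 1) (λ S → coeff (w S) 0) S + ι (λ i → coeff (r i) 0) (λ S → coeff (w S) 1) S
  coeff₁-ι r w []          = sym (+-identityˡ 0#)
  coeff₁-ι r w (false ∷ S) = trans (coeff-+ (ΛP.ι (r ∘ suc) (w ∘ (false ∷_)) S) _ 1)
    (trans (+-cong (coeff₁-ι (r ∘ suc) _ S) (coeff₁-* (r zero) (w (true ∷ S)))) (interchange _ _ _ _))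
  coeff₁-ι r w (true ∷ S)  = trans (coeff-neg (ΛP.ι (r ∘ suc) (w ∘ (true ∷_)) S) 1)
    (trans (-‿cong (coeff₁-ι (r ∘ suc) _ S)) (sym (-‿+-comm _ _)))

  coeff₀-ι* : ∀ {n} l (M : Fin l → ΛP.Row n) (w : ΛP.Λ n) S →
    coeff (ΛP.ι* l M w S) 0 ≈ ι* l (λ i s → coeff (M i s) 0) (λ S → coeff (w S) 0) S
  coeff₀-ι* zero    M w S = refl
  coeff₀-ι* (suc l) M w S = trans (coeff₀-ι* l (M ∘ suc) (ΛP.ι (M zero) w) S)
    (ι*-congʳ l _ (coeff₀-ι (M zero) w) S)

  -- The iterated product rule: the derivative falls on one of the rows, which `Dι*` collects, or on
  -- `w`.
  coeff₁-ι* : ∀ {n} l (M : Fin l → ΛP.Row n) (w : ΛP.Λ n) S → coeff (ΛP.ι* l M w S) 1 ≈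
    Dι* l (λ i s → coeff (M i s) 0) (λ i s → coeff (M i s) 1) (λ S → coeff (w S) 0) S
      + ι* l (λ i s → coeff (M i s) 0) (λ S → coeff (w S) 1) S
  coeff₁-ι* zero    M w S = sym (+-identityˡ _)
  coeff₁-ι* (suc l) M w S = begin
    coeff (ΛP.ι* l (M ∘ suc) (ΛP.ι (M zero) w) S) 1
      ≈⟨ coeff₁-ι* l (M ∘ suc) (ΛP.ι (M zero) w) S ⟩
    Dι* l M₀ M₁ (λ S → coeff (ΛP.ι (M zero) w S) 0) S + ι* l M₀ (λ S → coeff (ΛP.ι (M zero) w S) 1) S
      ≈⟨ +-cong (Dι*-cong l (λ _ _ → refl) (λ _ _ → refl) (coeff₀-ι (M zero) w) S)
                (trans (ι*-congʳ l M₀ (coeff₁-ι (M zero) w) S) (ι*-+ l M₀ _ _ S)) ⟩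
    Dι* l M₀ M₁ (ι r₀ w₀) S + (ι* l M₀ (ι r₁ w₀) S + ι* l M₀ (ι r₀ w₁) S)
      ≈⟨ trans (sym (+-assoc _ _ _)) (+-congʳ (+-comm _ _)) ⟩
    (ι* l M₀ (ι r₁ w₀) S + Dι* l M₀ M₁ (ι r₀ w₀) S) + ι* l M₀ (ι r₀ w₁) S ∎
    where
    M₀ M₁ : Fin l → Row _
    M₀ i s = coeff (M (suc i) s) 0
    M₁ i s = coeff (M (suc i) s) 1
    r₀ r₁ : Row _
    r₀ s = coeff (M zero s) 0
    r₁ s = coeff (M zero s) 1
    w₀ w₁ : Λ _
    w₀ S = coeff (w S) 0
    w₁ S = coeff (w S) 1

  coeff₀-top : ∀ {n} S → coeff (ΛP.top {n} S) 0 ≈ top S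
  coeff₀-top []          = refl
  coeff₀-top (false ∷ S) = refl
  coeff₀-top (true  ∷ S) = coeff₀-top S

  coeff₁-top : ∀ {n} S → coeff (ΛP.top {n} S) 1 ≈ 0#
  coeff₁-top []          = refl
  coeff₁-top (false ∷ S) = refl
  coeff₁-top (true  ∷ S) = coeff₁-top S

  coeff₀-det : ∀ n (M : RawOps.Mat (Poly rawRing) n) →
    coeff (RawOps.det (Poly rawRing) n M) 0 ≈ det n (λ a b → coeff (M a b) 0)
  coeff₀-det n M = begin
    coeff (RawOps.det (Poly rawRing) n M) 0
      ≈⟨ coeff-cong (ΛP.det-contraction n M) 0 ⟩
    coeff (ΛP.ι* n M ΛP.top (replicate n false)) 0
      ≈⟨ coeff₀-ι* n M ΛP.top _ ⟩
    scalarPart (ι* n (λ a b → coeff (M a b) 0) (λ S → coeff (ΛP.top S) 0))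
      ≈⟨ ι*-congʳ n _ coeff₀-top _ ⟩
    scalarPart (ι* n (λ a b → coeff (M a b) 0) top)
      ≈⟨ det-contraction n _ ⟨
    det n (λ a b → coeff (M a b) 0) ∎

  -- `top` is constant in the variable, so only the derivatives of the rows survive.
  coeff₁-det : ∀ n (M : RawOps.Mat (Poly rawRing) n) →
    coeff (RawOps.det (Poly rawRing) n M) 1 ≈ Ddet n (λ a b → coeff (M a b) 0) (λ a b → coeff (M a b) 1)
  coeff₁-det n M = begin
    coeff (RawOps.det (Poly rawRing) n M) 1
      ≈⟨ coeff-cong (ΛP.det-contraction n M) 1 ⟩
    coeff (ΛP.ι* n M ΛP.top (replicate n false)) 1
      ≈⟨ coeff₁-ι* n M ΛP.top _ ⟩
    scalarPart (Dι* n M₀ M₁ (λ S → coeff (ΛP.top S) 0)) + scalarPart (ι* n M₀ (λ S → coeff (ΛP.top S) 1))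
      ≈⟨ +-cong (Dι*-cong n (λ _ _ → refl) (λ _ _ → refl) coeff₀-top _) (ι*-0 n M₀ coeff₁-top _) ⟩
    Ddet n M₀ M₁ + 0#
      ≈⟨ +-identityʳ _ ⟩
    Ddet n M₀ M₁ ∎
    where
    M₀ M₁ : Mat n
    M₀ a b = coeff (M a b) 0
    M₁ a b = coeff (M a b) 1

  eval0-1-∂ : ∀ f → eval0 (f +P (-P (∂ f))) ≈ coeff f 0 + - coeff f 1
  eval0-1-∂ []          = sym (trans (+-identityˡ _) -0#≈0#)
  eval0-1-∂ (a ∷ [])    = sym (trans (+-congˡ -0#≈0#) (+-identityʳ a))
  eval0-1-∂ (a ∷ b ∷ f) = +-congˡ (-‿cong (+-identityʳ b))

-- Constants as a subring of the polynomials

module ConstantPolynomials {c ℓ} (R : CommutativeRing c ℓ) where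
  open CommutativeRing R hiding (zero)
  open PolyDef rawRing
  open PolynomialRing R
  open RawOps rawRing
  private
    module P = CommutativeRing (toCR (Poly rawRing) isCR)
    module OpsP = RawOps (Poly rawRing)

  C-cong : ∀ {a b} → a ≈ b → C a ≈P C b
  C-cong e = e , tt

  C-* : ∀ a b → C (a * b) ≈P (C a *P C b)
  C-* a b = sym (+-identityʳ _) , tt

  C-Σ : ∀ n (f : Fin n → Carrier) → C (ΣFin n f) ≈P OpsP.ΣFin n (λ i → C (f i))
  C-Σ zero    f = refl , tt
  C-Σ (suc n) f = P.+-congˡ (C-Σ n (f ∘ suc))

  C-fromℕ : ∀ n → C (fromℕ n) ≈P OpsP.fromℕ n
  C-fromℕ zero    = refl , tt
  C-fromℕ (suc n) = P.+-congˡ (C-fromℕ n)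

  C-^ : ∀ a n → C (a ^ n) ≈P (C a OpsP.^ n)
  C-^ a zero    = refl , tt
  C-^ a (suc n) = P.trans (C-* a (a ^ n)) (P.*-congˡ {C a} (C-^ a n))

  coeff-Σ : ∀ n (f : Fin n → P) k → coeff (OpsP.ΣFin n f) k ≈ ΣFin n (λ i → coeff (f i) k)
  coeff-Σ zero    f k = refl
  coeff-Σ (suc n) f k = trans (coeff-+ (f zero) _ k) (+-congˡ (coeff-Σ n (f ∘ suc) k))

-- The functional ∏ (1 - ∂_{z_i}) at 0, applied to determinants of pencils

module MixedDeterminants {c ℓ} (R : CommutativeRing c ℓ) where
  open CommutativeRing R hiding (zero)
  open RawOps rawRing

  R[_] : ℕ → CommutativeRing c ℓ
  R[ n ] = toCR (PolyN n rawRing) (PolyN-isCR n isCommutativeRing)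

  module R[z] (n : ℕ) where
    open CommutativeRing R[ n ] public hiding (zero; rawRing)
    open RawOps (PolyN n rawRing) public

  const : ∀ n → Carrier → R[z].Carrier n
  const = constN rawRing

  const-cong : ∀ n {a b} → a ≈ b → R[z]._≈_ n (const n a) (const n b)
  const-cong zero    e = e
  const-cong (suc n) e = const-cong n e , tt

  const-+ : ∀ n a b → R[z]._≈_ n (const n (a + b)) (R[z]._+_ n (const n a) (const n b))
  const-+ zero    a b = refl
  const-+ (suc n) a b = const-+ n a b , tt

  const-* : ∀ n a b → R[z]._≈_ n (const n (a * b)) (R[z]._*_ n (const n a) (const n b))
  const-* zero    a b = refl
  const-* (suc n) a b = R[z].trans n (const-* n a b) (R[z].sym n (R[z].+-identityʳ n _)) , tt

  const-neg : ∀ n a → R[z]._≈_ n (const n (- a)) (R[z].-_ n (const n a))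
  const-neg zero    a = refl
  const-neg (suc n) a = const-neg n a , tt

  const-0 : ∀ n → R[z]._≈_ n (const n 0#) (R[z].0# n)
  const-0 zero    = refl
  const-0 (suc n) = const-0 n , tt

  const-1 : ∀ n → R[z]._≈_ n (const n 1#) (R[z].1# n)
  const-1 zero    = refl
  const-1 (suc n) = const-1 n , tt

  const-Σ : ∀ n k (f : Fin k → Carrier) →
    R[z]._≈_ n (const n (ΣFin k f)) (R[z].ΣFin n k (λ j → const n (f j)))
  const-Σ n zero    f = const-0 n
  const-Σ n (suc k) f = R[z].trans n (const-+ n _ _) (R[z].+-congˡ n (const-Σ n k (f ∘ suc)))

  const-fromℕ : ∀ n k → R[z]._≈_ n (const n (fromℕ k)) (R[z].fromℕ n k)
  const-fromℕ n zero    = const-0 n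
  const-fromℕ n (suc k) = R[z].trans n (const-+ n _ _) (R[z].+-cong n (const-1 n) (const-fromℕ n k))

  L : ∀ n → R[z].Carrier n → Carrier
  L = oneMinusDerivAt0 rawRing

  module Coeff (n : ℕ) where
    open PolynomialRing R[ n ] public
    open DeterminantDerivative R[ n ] public
    open ConstantPolynomials R[ n ] public using (coeff-Σ)

  -- `L` is defined by matching on lists. `L-suc` rewrites it through coefficients, which respect
  -- equality up to trailing zeros, and the two statements support each other in a recursion on n.
  L-cong : ∀ n {f g} → R[z]._≈_ n f g → L n f ≈ L n g
  L-suc : ∀ n f → L (suc n) f ≈ L n (R[z]._+_ n (Coeff.coeff n f 0) (R[z].-_ n (Coeff.coeff n f 1)))

  L-suc n f = L-cong n (Coeff.eval0-1-∂ n f)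

  L-cong zero    e = e
  L-cong (suc n) {f} {g} e = trans (L-suc n f) (trans
    (L-cong n (+-cong′ (Coeff.coeff-cong n e 0) (neg-cong (Coeff.coeff-cong n e 1)))) (sym (L-suc n g)))
    where open R[z] n using () renaming (+-cong to +-cong′; -‿cong to neg-cong)

  L-+ : ∀ n f g → L n (R[z]._+_ n f g) ≈ L n f + L n g
  L-+ zero    f g = refl
  L-+ (suc n) f g = begin
    L (suc n) (R[z]._+_ (suc n) f g)
      ≈⟨ L-suc n (R[z]._+_ (suc n) f g) ⟩
    L n (coeff (R[z]._+_ (suc n) f g) 0 +′ -′ coeff (R[z]._+_ (suc n) f g) 1)
      ≈⟨ L-cong n (T.+-cong (coeff-+ f g 0) (T.-‿cong (coeff-+ f g 1))) ⟩
    L n ((coeff f 0 +′ coeff g 0) +′ -′ (coeff f 1 +′ coeff g 1))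
      ≈⟨ L-cong n (T.+-congˡ (-‿+-comm _ _)) ⟨
    L n ((coeff f 0 +′ coeff g 0) +′ (-′ coeff f 1 +′ -′ coeff g 1))
      ≈⟨ L-cong n (interchange _ _ _ _) ⟩
    L n ((coeff f 0 +′ -′ coeff f 1) +′ (coeff g 0 +′ -′ coeff g 1))
      ≈⟨ L-+ n _ _ ⟩
    L n (coeff f 0 +′ -′ coeff f 1) + L n (coeff g 0 +′ -′ coeff g 1)
      ≈⟨ +-cong (L-suc n f) (L-suc n g) ⟨
    L (suc n) f + L (suc n) g ∎
    where
    module T = R[z] n
    open T using () renaming (_+_ to _+′_; -_ to -′_)
    open Coeff n
    open RingProperties T.ring using (-‿+-comm)
    open CommutativeSemigroupProperties T.+-commutativeSemigroup using (interchange)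
    open SetoidReasoning setoid

  L-const* : ∀ n a f → L n (R[z]._*_ n (const n a) f) ≈ a * L n f
  L-const* zero    a f = refl
  L-const* (suc n) a f = begin
    L (suc n) (R[z]._*_ (suc n) (const (suc n) a) f)
      ≈⟨ L-suc n (R[z]._*_ (suc n) (const (suc n) a) f) ⟩
    L n (coeff (R[z]._*_ (suc n) (const (suc n) a) f) 0 +′ -′ coeff (R[z]._*_ (suc n) (const (suc n) a) f) 1)
      ≈⟨ L-cong n (T.+-cong (*P-C (const n a) f 0) (T.-‿cong (*P-C (const n a) f 1))) ⟩
    L n (const n a *′ coeff f 0 +′ -′ (const n a *′ coeff f 1))
      ≈⟨ L-cong n (T.+-congˡ (-‿distribʳ-* _ _)) ⟩
    L n (const n a *′ coeff f 0 +′ const n a *′ (-′ coeff f 1))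
      ≈⟨ L-cong n (T.distribˡ _ _ _) ⟨
    L n (const n a *′ (coeff f 0 +′ -′ coeff f 1))
      ≈⟨ L-const* n a _ ⟩
    a * L n (coeff f 0 +′ -′ coeff f 1)
      ≈⟨ *-congˡ (L-suc n f) ⟨
    a * L (suc n) f ∎
    where
    module T = R[z] n
    open T using () renaming (_+_ to _+′_; _*_ to _*′_; -_ to -′_)
    open Coeff n
    open RingProperties T.ring using (-‿distribʳ-*)
    open SetoidReasoning setoid

  L-0 : ∀ n → L n (R[z].0# n) ≈ 0#
  L-0 n = begin
    L n (R[z].0# n)                                    ≈⟨ L-cong n (R[z].zeroʳ n _) ⟨
    L n (R[z]._*_ n (const n 0#) (R[z].0# n))          ≈⟨ L-const* n 0# _ ⟩
    0# * L n (R[z].0# n)                               ≈⟨ zeroˡ _ ⟩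
    0#                                                 ∎
    where open SetoidReasoning setoid

  L-Σ : ∀ n k (f : Fin k → R[z].Carrier n) → L n (R[z].ΣFin n k f) ≈ ΣFin k (λ j → L n (f j))
  L-Σ n zero    f = L-0 n
  L-Σ n (suc k) f = trans (L-+ n _ _) (+-congˡ (L-Σ n k (f ∘ suc)))

  -- `Q` is arbitrary rather than x I_d because each eliminated variable subtracts a rank-one matrix
  -- from it.
  pencil : ∀ {d} m → Mat d → (Fin m → Mat d) → R[z].Mat m d
  pencil m Q Xs a b =
    R[z]._+_ m (const m (Q a b)) (R[z].ΣFin m m (λ i → R[z]._*_ m (varN rawRing m i) (const m (Xs i a b))))

  module _ {d} m (Q : Mat d) (Xs : Fin (suc m) → Mat d) (a b : Fin d) where
    private
      module T = R[z] m
      open T using () renaming (_≈_ to _≈′_; _+_ to _+′_; _*_ to _*′_)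
      open Coeff m
      open FiniteSums R[ m ] using () renaming (Σ-cong to Σ-cong′; Σ-zero to Σ-zero′)
      open SetoidReasoning T.setoid
      module T⁺ = R[z] (suc m)

      term : Fin (suc m) → T⁺.Carrier
      term i = varN rawRing (suc m) i T⁺.* const (suc m) (Xs i a b)

    coeff₀-pencil : coeff (pencil (suc m) Q Xs a b) 0 ≈′ pencil m Q (Xs ∘ suc) a b
    coeff₀-pencil = begin
      coeff (pencil (suc m) Q Xs a b) 0
        ≈⟨ coeff-+ (const (suc m) (Q a b)) (T⁺.ΣFin (suc m) term) 0 ⟩
      const m (Q a b) +′ coeff (T⁺.ΣFin (suc m) term) 0
        ≈⟨ T.+-congˡ (coeff-Σ (suc m) term 0) ⟩
      const m (Q a b) +′ (coeff (term zero) 0 +′ T.ΣFin m (λ i → coeff (term (suc i)) 0))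
        ≈⟨ T.+-congˡ (T.+-cong (T.trans (coeff₀-* (varN rawRing (suc m) zero) (const (suc m) (Xs zero a b))) (T.zeroˡ _))
             (Σ-cong′ m (λ i → coeff₀-* (varN rawRing (suc m) (suc i)) (const (suc m) (Xs (suc i) a b))))) ⟩
      const m (Q a b) +′ (T.0# +′ T.ΣFin m (λ i → varN rawRing m i *′ const m (Xs (suc i) a b)))
        ≈⟨ T.+-congˡ (T.+-identityˡ _) ⟩
      pencil m Q (Xs ∘ suc) a b ∎

    coeff₁-pencil : coeff (pencil (suc m) Q Xs a b) 1 ≈′ const m (Xs zero a b)
    coeff₁-pencil = begin
      coeff (pencil (suc m) Q Xs a b) 1
        ≈⟨ coeff-+ (const (suc m) (Q a b)) (T⁺.ΣFin (suc m) term) 1 ⟩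
      T.0# +′ coeff (T⁺.ΣFin (suc m) term) 1
        ≈⟨ T.trans (T.+-identityˡ _) (coeff-Σ (suc m) term 1) ⟩
      coeff (term zero) 1 +′ T.ΣFin m (λ i → coeff (term (suc i)) 1)
        ≈⟨ T.+-cong first (Σ-zero′ m rest) ⟩
      const m (Xs zero a b) +′ T.0#
        ≈⟨ T.+-identityʳ _ ⟩
      const m (Xs zero a b) ∎
      where
      first : coeff (term zero) 1 ≈′ const m (Xs zero a b)
      first = begin
        coeff (term zero) 1
          ≈⟨ coeff₁-* (varN rawRing (suc m) zero) (const (suc m) (Xs zero a b)) ⟩
        T.1# *′ const m (Xs zero a b) +′ T.0# *′ T.0#
          ≈⟨ T.+-cong (T.*-identityˡ _) (T.zeroˡ _) ⟩
        const m (Xs zero a b) +′ T.0#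
          ≈⟨ T.+-identityʳ _ ⟩
        const m (Xs zero a b) ∎
      rest : ∀ i → coeff (term (suc i)) 1 ≈′ T.0#
      rest i = begin
        coeff (term (suc i)) 1
          ≈⟨ coeff₁-* (varN rawRing (suc m) (suc i)) (const (suc m) (Xs (suc i) a b)) ⟩
        T.0# *′ const m (Xs (suc i) a b) +′ varN rawRing m i *′ T.0#
          ≈⟨ T.+-cong (T.zeroˡ _) (T.zeroʳ _) ⟩
        T.0# +′ T.0#
          ≈⟨ T.+-identityˡ _ ⟩
        T.0# ∎

  -- The outermost variable contributes det N - Σ_j D_j. After multiplication by k this splits into
  -- the k terms det N - k D_j, each an exact rank-one update. The update is constant in the other
  -- variables, so a pencil with one variable fewer results.
  L-det-pencil : ∀ d m k (Q : Mat d) (Xs : Fin (suc m) → Mat d) (u v : Fin k → Fin d → Carrier) →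
    (∀ a b → Xs zero a b ≈ ΣFin k (λ j → u j a * v j b)) →
    fromℕ k * L (suc m) (R[z].det (suc m) d (pencil (suc m) Q Xs)) ≈
    ΣFin k (λ j → L m (R[z].det m d (pencil m (λ a b → Q a b + (- (fromℕ k * u j a)) * v j b) (Xs ∘ suc))))
  L-det-pencil d m k Q Xs u v hX = let open SetoidReasoning setoid in begin
    fromℕ k * L (suc m) f
      ≈⟨ *-congˡ (trans (L-suc m f) (L-cong m (T.+-cong coeff₀-f (T.-‿cong coeff₁-f)))) ⟩
    fromℕ k * L m (T.det d N T.+ T.- T.ΣFin k D)
      ≈⟨ L-const* m (fromℕ k) _ ⟨
    L m (K T.* (T.det d N T.+ T.- T.ΣFin k D))
      ≈⟨ L-cong m collect ⟨
    L m (T.ΣFin k (λ j → T.det d N T.+ (T.- K) T.* D j))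
      ≈⟨ L-cong m (ΣT.Σ-cong k (λ j → T.sym (perturb j))) ⟩
    L m (T.ΣFin k (λ j → T.det d (pencil m (Q′ j) (Xs ∘ suc))))
      ≈⟨ L-Σ m k _ ⟩
    ΣFin k (λ j → L m (T.det d (pencil m (Q′ j) (Xs ∘ suc)))) ∎
    where
    module T = R[z] m
    module ΣT = FiniteSums R[ m ]
    module ΛT = Contraction R[ m ]
    open Coeff m
    open RingProperties T.ring using (-‿distribˡ-*; -‿distribʳ-*)
    f = R[z].det (suc m) d (pencil (suc m) Q Xs)
    N = pencil m Q (Xs ∘ suc)
    K = const m (fromℕ k)
    Q′ : Fin k → Mat d
    Q′ j a b = Q a b + (- (fromℕ k * u j a)) * v j b
    uv : Fin k → T.Mat d
    uv j a b = const m (u j a) T.* const m (v j b)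
    D : Fin k → T.Carrier
    D j = ΛT.Ddet d N (uv j)

    coeff₀-f : coeff f 0 T.≈ T.det d N
    coeff₀-f = T.trans (coeff₀-det d (pencil (suc m) Q Xs)) (ΛT.det-cong d (coeff₀-pencil m Q Xs))

    const-X : ∀ a b → const m (Xs zero a b) T.≈ T.ΣFin k (λ j → uv j a b)
    const-X a b = T.trans (const-cong m (hX a b))
      (T.trans (const-Σ m k _) (ΣT.Σ-cong k (λ j → const-* m (u j a) (v j b))))

    coeff₁-f : coeff f 1 T.≈ T.ΣFin k D
    coeff₁-f = T.trans (coeff₁-det d (pencil (suc m) Q Xs)) (T.trans
      (ΛT.Ddet-cong d (coeff₀-pencil m Q Xs)
        (λ a b → T.trans (coeff₁-pencil m Q Xs a b) (const-X a b)))
      (ΛT.Ddet-Σ d N k uv))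

    -- The k copies of det N tie the scale of the perturbation to the number of rank-one summands.
    collect : T.ΣFin k (λ j → T.det d N T.+ (T.- K) T.* D j) T.≈ K T.* (T.det d N T.+ T.- T.ΣFin k D)
    collect = let open SetoidReasoning T.setoid in begin
      T.ΣFin k (λ j → T.det d N T.+ (T.- K) T.* D j)
        ≈⟨ ΣT.Σ-+ k (λ _ → T.det d N) _ ⟩
      T.ΣFin k (λ _ → T.det d N) T.+ T.ΣFin k (λ j → (T.- K) T.* D j)
        ≈⟨ T.+-cong (T.trans (ΣT.Σ-const k _) (T.*-congʳ (T.sym (const-fromℕ m k)))) (ΣT.Σ-*ˡ k (T.- K) D) ⟩
      K T.* T.det d N T.+ (T.- K) T.* T.ΣFin k D
        ≈⟨ T.+-congˡ (T.trans (T.sym (-‿distribˡ-* _ _)) (-‿distribʳ-* _ _)) ⟩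
      K T.* T.det d N T.+ K T.* (T.- T.ΣFin k D)
        ≈⟨ T.sym (T.distribˡ _ _ _) ⟩
      K T.* (T.det d N T.+ T.- T.ΣFin k D) ∎

    perturb : ∀ j → T.det d (pencil m (Q′ j) (Xs ∘ suc)) T.≈ (T.det d N T.+ (T.- K) T.* D j)
    perturb j = T.trans (ΛT.det-cong d entry) (T.trans
      (ΛT.det-rank-one d N (λ a → (T.- K) T.* const m (u j a)) (λ b → const m (v j b)))
      (T.+-congˡ (T.trans (ΛT.Ddet-cong d (λ _ _ → T.refl) (λ a b → T.*-assoc _ _ _))
        (ΛT.Ddet-* d N (T.- K) (uv j)))))
      where
      const-entry : ∀ a b → const m ((- (fromℕ k * u j a)) * v j b) T.≈
        ((T.- K) T.* const m (u j a)) T.* const m (v j b)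
      const-entry a b = T.trans (const-* m _ _) (T.*-congʳ (T.trans (const-neg m _)
        (T.trans (T.-‿cong (const-* m _ _)) (-‿distribˡ-* _ _))))
      entry : ∀ a b → pencil m (Q′ j) (Xs ∘ suc) a b T.≈
        (N a b T.+ ((T.- K) T.* const m (u j a)) T.* const m (v j b))
      entry a b = T.trans (T.+-congʳ (T.trans (const-+ m _ _) (T.+-congˡ (const-entry a b))))
        (T.trans (T.+-assoc _ _ _) (T.trans (T.+-congˡ (T.+-comm _ _)) (T.sym (T.+-assoc _ _ _))))

-- Averaging over all partitions and passage to the matrix A

module MixedCharacteristic {c ℓ} (F : ConjField c ℓ) where
  open ConjField F hiding (zero)
  open Objects F
  open ConstantPolynomials commRing

  F[x] : CommutativeRing c ℓ
  F[x] = toCR Fx (PolynomialRing.isCR commRing)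

  private
    module Px = CommutativeRing F[x]
    module OpsP = RawOps Fx
  open FiniteSums F[x]
  open MixedDeterminants F[x]
  open Contraction F[x] using (det-cong)
  open BlockDeterminants F[x] using (sylvester)
  open RingProperties Px.ring using (-‿distribˡ-*)
  open CommutativeSemigroupProperties Px.*-commutativeSemigroup using () renaming (x∙yz≈y∙xz to x*yz≈y*xz)

  C-δ : ∀ {n} (i j : Fin n) → C (δ i j) ≈P kronecker i j
  C-δ zero    zero    = Px.refl {C 1#}
  C-δ zero    (suc j) = refl , tt
  C-δ (suc i) zero    = refl , tt
  C-δ (suc i) (suc j) = C-δ i j

  ΣAssign-cong : ∀ m k {f g : (Fin m → Fin k) → Px} → (∀ σ → f σ ≈P g σ) → ΣAssign m k f ≈P ΣAssign m k g
  ΣAssign-cong zero    k h = h (λ ())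
  ΣAssign-cong (suc m) k h = Σ-cong k (λ j → ΣAssign-cong m k (λ σ → h (consF j σ)))

  ΣAssign-*ˡ : ∀ m k p (f : (Fin m → Fin k) → Px) → ΣAssign m k (λ σ → p *P f σ) ≈P (p *P ΣAssign m k f)
  ΣAssign-*ˡ zero    k p f = Px.refl {p *P f (λ ())}
  ΣAssign-*ˡ (suc m) k p f = Px.trans (Σ-cong k (λ j → ΣAssign-*ˡ m k p (λ σ → f (consF j σ))))
    (Σ-*ˡ k p (λ j → ΣAssign m k (λ σ → f (consF j σ))))

  module _ (d k : ℕ) where
    private
      K : Px
      K = OpsP.fromℕ k

    rankOneDet : ∀ m → OpsP.Mat d → (u v : Fin m → Fin k → Fin d → Px) → (Fin m → Fin k) → Px
    rankOneDet m Q u v σ = detP d (λ a b → Q a b +P ΣP m (λ i → (-P (K *P u i (σ i) a)) *P v i (σ i) b))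

    -- Eliminating a variable picks one of its k rank-one terms, so m eliminations pick a block
    -- index for each i in [m], that is, an element of P_k(m). Each elimination uses up one factor
    -- k.
    average : ∀ m (Q : OpsP.Mat d) (Xs : Fin m → OpsP.Mat d) (u v : Fin m → Fin k → Fin d → Px) →
      (∀ i a b → Xs i a b ≈P ΣP k (λ j → u i j a *P v i j b)) →
      ((K ^P m) *P L m (R[z].det m d (pencil m Q Xs))) ≈P ΣAssign m k (rankOneDet m Q u v)
    average zero    Q Xs u v hX = Px.*-identityˡ _
    average (suc m) Q Xs u v hX = begin
      (K *P (K ^P m)) *P L (suc m) D
        ≈⟨ Px.*-congʳ {L (suc m) D} (Px.*-comm K (K ^P m)) ⟩
      ((K ^P m) *P K) *P L (suc m) D
        ≈⟨ Px.*-assoc (K ^P m) K (L (suc m) D) ⟩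
      (K ^P m) *P (K *P L (suc m) D)
        ≈⟨ Px.*-congˡ {K ^P m} (L-det-pencil d m k Q Xs (u zero) (v zero) (hX zero)) ⟩
      (K ^P m) *P ΣP k (λ j → L m (D′ j))
        ≈⟨ Σ-*ˡ k (K ^P m) (λ j → L m (D′ j)) ⟨
      ΣP k (λ j → (K ^P m) *P L m (D′ j))
        ≈⟨ Σ-cong k (λ j → average m (Q′ j) (Xs ∘ suc) (u ∘ suc) (v ∘ suc) (hX ∘ suc)) ⟩
      ΣP k (λ j → ΣAssign m k (rankOneDet m (Q′ j) (u ∘ suc) (v ∘ suc)))
        -- The perturbation stored in `Q′ j` is released as the summand of index zero.
        ≈⟨ Σ-cong k (λ j → ΣAssign-cong m k (λ σ → det-cong d (λ a b → Px.+-assoc (Q a b) _ _))) ⟩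
      ΣAssign (suc m) k (rankOneDet (suc m) Q u v) ∎
      where
      open SetoidReasoning Px.setoid
      D = R[z].det (suc m) d (pencil (suc m) Q Xs)
      Q′ : Fin k → OpsP.Mat d
      Q′ j a b = Q a b +P ((-P (K *P u zero j a)) *P v zero j b)
      D′ : Fin k → R[z].Carrier m
      D′ j = R[z].det m d (pencil m (Q′ j) (Xs ∘ suc))

  Amat-combine : ∀ d m k u v j i j′ i′ → Amat d m k u v (combine j i) (combine j′ i′) ≡
    ΣFin d (λ a → conj (v i j a) * u i′ j′ a)
  Amat-combine d m k u v j i j′ i′ = ≡.cong₂
    (λ { (j , i) (j′ , i′) → ΣFin d (λ a → conj (v i j a) * u i′ j′ a) })
    (remQuot-combine {k} {m} j i) (remQuot-combine {k} {m} j′ i′)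

  fromℕ^≉0 : ∀ k m → ¬ (RawOps._^_ rawRing (fromℕ (suc k)) m ≈ 0#)
  -- `fromℕ 1` is `1# + 0#`, so characteristic zero at 0 yields 1 ≠ 0.
  fromℕ^≉0 k zero    e = charZero 0 (trans (+-identityʳ 1#) e)
  fromℕ^≉0 k (suc m) e = fromℕ^≉0 k m (begin
    κ ^ m                  ≈⟨ *-identityˡ _ ⟨
    1# * (κ ^ m)           ≈⟨ *-congʳ (inverseʳ κ (charZero k)) ⟨
    (κ * κ ⁻¹) * (κ ^ m)   ≈⟨ *-congʳ (*-comm κ (κ ⁻¹)) ⟩
    (κ ⁻¹ * κ) * (κ ^ m)   ≈⟨ *-assoc _ _ _ ⟩
    κ ⁻¹ * (κ * (κ ^ m))   ≈⟨ *-congˡ e ⟩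
    κ ⁻¹ * 0#              ≈⟨ zeroʳ _ ⟩
    0#                     ∎)
    where
    open SetoidReasoning setoid
    κ = fromℕ (suc k)

  module _ (d m k : ℕ) (u v : Fin m → Fin k → Fin d → Carrier) where
    private
      K′ : Px
      K′ = OpsP.fromℕ k

      -- The factor -k sits entirely in `U`. Thus U V is -k Σ_i u_i v_i^* and V U is -k A(S), and
      -- Sylvester's identity with plus signs gives both characteristic polynomials.
      U : (Fin m → Fin k) → Fin d → Fin m → Px
      U σ a p = -P (K′ *P C (u p (σ p) a))

      V : (Fin m → Fin k) → Fin m → Fin d → Px
      V σ p a = C (conj (v p (σ p) a))

    charPoly-subMat : ∀ σ →
      detP m (λ p q → (X *P kronecker p q) +P ΣP d (λ a → V σ p a *P U σ a q)) ≈P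
      charPoly m (subMat k m (scale (fromℕ k) (Amat d m k u v)) σ)
    charPoly-subMat σ = det-cong m λ p q →
      Px.+-cong (Px.*-congˡ {X} (Px.sym (C-δ p q))) (entry p q)
      where
      open SetoidReasoning Px.setoid
      A : Fin m → Fin m → Carrier
      A p q = Amat d m k u v (combine (σ p) p) (combine (σ q) q)
      vu : Fin m → Fin m → Fin d → Px
      vu p q a = C (conj (v p (σ p) a)) *P C (u q (σ q) a)
      C-A : ∀ p q → C (A p q) ≈P ΣP d (vu p q)
      C-A p q = Px.trans (C-cong (reflexive (Amat-combine d m k u v (σ p) p (σ q) q)))
        (Px.trans (C-Σ d _) (Σ-cong d (λ a → C-* (conj (v p (σ p) a)) (u q (σ q) a))))
      move : ∀ x y z → (x *P (-P (y *P z))) ≈P ((-P y) *P (x *P z))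
      move x y z = Px.trans (Px.*-congˡ {x} (-‿distribˡ-* y z)) (x*yz≈y*xz x (-P y) z)
      entry : ∀ p q → ΣP d (λ a → V σ p a *P U σ a q) ≈P (-P (C (fromℕ k * A p q)))
      entry p q = begin
        ΣP d (λ a → V σ p a *P U σ a q)      ≈⟨ Σ-cong d (λ a → move (V σ p a) K′ (C (u q (σ q) a))) ⟩
        ΣP d (λ a → (-P K′) *P vu p q a)     ≈⟨ Σ-*ˡ d (-P K′) (vu p q) ⟩
        (-P K′) *P ΣP d (vu p q)             ≈⟨ -‿distribˡ-* K′ (ΣP d (vu p q)) ⟨
        -P (K′ *P ΣP d (vu p q))             ≈⟨ Px.-‿cong (Px.*-cong (C-fromℕ k) (C-A p q)) ⟨
        -P (C (fromℕ k) *P C (A p q))        ≈⟨ Px.-‿cong {C (fromℕ k * A p q)} {C (fromℕ k) *P C (A p q)} (C-* (fromℕ k) (A p q)) ⟨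
        -P (C (fromℕ k * A p q))             ∎

    μ-average : (Xs : Fin m → Mat d) →
      (∀ i a b → Xs i a b ≈ ΣFin k (λ j → u i j a * conj (v i j b))) →
      ((K′ ^P m) *P μ d m Xs) ≈P
      ΣAssign m k (λ σ → detP d (λ a b → (X *P kronecker a b) +P ΣP m (λ p → U σ a p *P V σ p b)))
    μ-average Xs hX = Px.trans
      (Px.*-congˡ {K′ ^P m} (L-cong m (Contraction.det-cong R[ m ] d entry)))
      (average d k m (λ a b → X *P kronecker a b) (λ i a b → C (Xs i a b))
        (λ i j a → C (u i j a)) (λ i j b → C (conj (v i j b))) C-X)
      where
      module T = R[z] m
      C-X : ∀ i a b → C (Xs i a b) ≈P ΣP k (λ j → C (u i j a) *P C (conj (v i j b)))
      C-X i a b = Px.trans (C-cong (hX i a b))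
        (Px.trans (C-Σ k _) (Σ-cong k (λ j → C-* (u i j a) (conj (v i j b)))))
      entry : ∀ a b →
        ((const m X T.* const m (C (δ a b))) T.+ T.ΣFin m (λ i → varN Fx m i T.* const m (C (Xs i a b)))) T.≈
        pencil m (λ a b → X *P kronecker a b) (λ i a b → C (Xs i a b)) a b
      entry a b = T.+-congʳ (T.trans (T.sym (const-* m X (C (δ a b))))
        (const-cong m (Px.*-congˡ {X} (C-δ a b))))

    -- Sylvester's identity holds for each choice `σ` separately, with powers of `X` independent of
    -- `σ`, so these leave the sum.
    X^m*K^m*μ : (Xs : Fin m → Mat d) →
      (∀ i a b → Xs i a b ≈ ΣFin k (λ j → u i j a * conj (v i j b))) →
      ((X ^P m) *P ((K′ ^P m) *P μ d m Xs)) ≈P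
      ((X ^P d) *P ΣAssign m k (λ σ → charPoly m (subMat k m (scale (fromℕ k) (Amat d m k u v)) σ)))
    X^m*K^m*μ Xs hX = begin
      (X ^P m) *P ((K′ ^P m) *P μ d m Xs)
        ≈⟨ Px.*-congˡ {X ^P m} (μ-average Xs hX) ⟩
      (X ^P m) *P ΣAssign m k small
        ≈⟨ ΣAssign-*ˡ m k (X ^P m) small ⟨
      ΣAssign m k (λ σ → (X ^P m) *P small σ)
        ≈⟨ ΣAssign-cong m k (λ σ → Px.trans (sylvester m d X (U σ) (V σ))
             (Px.*-congˡ {X ^P d} (charPoly-subMat σ))) ⟩
      ΣAssign m k (λ σ → (X ^P d) *P large σ)
        ≈⟨ ΣAssign-*ˡ m k (X ^P d) large ⟩
      (X ^P d) *P ΣAssign m k large ∎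
      where
      open SetoidReasoning Px.setoid
      small large : (Fin m → Fin k) → Px
      small σ = detP d (λ a b → (X *P kronecker a b) +P ΣP m (λ p → U σ a p *P V σ p b))
      large σ = charPoly m (subMat k m (scale (fromℕ k) (Amat d m k u v)) σ)

-- The exponent d - m may be negative, so the identity of rational functions is stated with x^m
-- cleared; `X ^P m` is no zero divisor in F[x], so the two forms are equivalent.
theorem3p8 : ∀ {c ℓ} (F : ConjField c ℓ) (d m k : ℕ) → 1 ≤ k →
    let open ConjField F
        open Objects F
    in (Xs : Fin m → Mat d) (u v : Fin m → Fin k → Fin d → Carrier) →
       (∀ i a b → Xs i a b ≈ ΣFin k (λ j → u i j a * conj (v i j b))) →
       ((X ^P m) *P μ d m Xs) ≈P ((X ^P d) *P ψ k m (scale (fromℕ k) (Amat d m k u v)))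
-- Positivity of the number of blocks enters here: in characteristic zero it makes
-- `fromℕ (suc k) ^ m` invertible.
theorem3p8 F d m (suc k) (s≤s _) Xs u v hX = begin
  (X ^P m) *P μ d m Xs
    ≈⟨ Px.*-congˡ {X ^P m} (Px.*-identityˡ (μ d m Xs)) ⟨
  (X ^P m) *P (C 1# *P μ d m Xs)
    ≈⟨ Px.*-congˡ {X ^P m} (Px.*-congʳ {μ d m Xs} c*K^m) ⟨
  (X ^P m) *P ((c′ *P (K′ ^P m)) *P μ d m Xs)
    ≈⟨ Px.*-congˡ {X ^P m} (Px.*-assoc c′ (K′ ^P m) (μ d m Xs)) ⟩
  (X ^P m) *P (c′ *P ((K′ ^P m) *P μ d m Xs))
    ≈⟨ x*yz≈y*xz (X ^P m) c′ ((K′ ^P m) *P μ d m Xs) ⟩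
  c′ *P ((X ^P m) *P ((K′ ^P m) *P μ d m Xs))
    ≈⟨ Px.*-congˡ {c′} (X^m*K^m*μ d m (suc k) u v Xs hX) ⟩
  c′ *P ((X ^P d) *P S)
    ≈⟨ x*yz≈y*xz c′ (X ^P d) S ⟩
  (X ^P d) *P (c′ *P S) ∎
  where
  open ConjField F
  open Objects F
  open MixedCharacteristic F
  open ConstantPolynomials commRing
  module Px = CommutativeRing F[x]
  open CommutativeSemigroupProperties Px.*-commutativeSemigroup using () renaming (x∙yz≈y∙xz to x*yz≈y*xz)
  open SetoidReasoning Px.setoid
  κ = fromℕ (suc k) ^ m
  c′ = C (κ ⁻¹)
  K′ = RawOps.fromℕ Fx (suc k)
  S = ΣAssign m (suc k) (λ σ → charPoly m (subMat (suc k) m (scale (fromℕ (suc k)) (Amat d m (suc k) u v)) σ))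
  -- `ψ` is normalised by a scalar of F, whereas the averaging yields a power of a numeral of F[x].
  -- They agree because `C` is a ring homomorphism.
  K^m : C κ ≈P (K′ ^P m)
  K^m = Px.trans (C-^ (fromℕ (suc k)) m) (^-cong m (C-fromℕ (suc k)))
    where
    ^-cong : ∀ m {p q} → p ≈P q → (p ^P m) ≈P (q ^P m)
    ^-cong zero    e = Px.refl {C 1#}
    ^-cong (suc m) e = Px.*-cong e (^-cong m e)
  c*K^m : (c′ *P (K′ ^P m)) ≈P C 1#
  c*K^m = begin
    c′ *P (K′ ^P m)   ≈⟨ Px.*-congˡ {c′} K^m ⟨
    c′ *P C κ         ≈⟨ C-* (κ ⁻¹) κ ⟨
    C (κ ⁻¹ * κ)      ≈⟨ C-cong (trans (*-comm (κ ⁻¹) κ) (inverseʳ κ (fromℕ^≉0 k m))) ⟩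
    C 1#              ∎
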